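{- For integers $n\geq m\geq 2$ with $n-m$ odd, the polynomial $K_q(n,m)$ is symmetric and unimodal: writing $K_q(n,m)=\sum_{i=0}^{D}c_iq^i$ with $D=m(n-m)+m$, one has $c_i=c_{D-i}$ for all $0\le i\le D$, and $c_0\le c_1\le\cdots\le c_{\lfloor D/2\rfloor}\ge c_{\lfloor D/2\rfloor+1}\ge\cdots\ge c_D$.
   Context: For integers $n\ge m\ge 0$ the Gaussian polynomial is ${n\brack m}=\prod_{i=0}^{m-1}\frac{1-q^{n-i}}{1-q^{m-i}}$. For $n\geq 1$ and $0\le m\le n$, the $q$-Kaplansky number is $K_q(n,m)=\frac{1-q^{n+m}}{1-q^{n}}{n\brack m}$, a polynomial in $q$ of degree $m(n-m)+m$. -}

module Defs where

open import Data.Bool.Base using (if_then_else_)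
open import Data.Fin.Base using (Fin; toℕ)
open import Data.Integer.Base using (ℤ; 0ℤ; 1ℤ; _*_; _-_; _≤_)
open import Data.Integer.Properties using (+-0-monoid)
open import Data.Nat.Base as ℕ using (ℕ; _∸_)
open import Data.Nat.Divisibility using (_∣?_)
open import Data.Product.Base using (_×_)
open import Data.Vec.Functional using (Vector; foldr)
open import Relation.Binary.PropositionalEquality.Core using (_≡_)
open import Relation.Nullary.Decidable.Core using (does)

open import Algebra.Properties.Monoid.Sum +-0-monoid using (sum⁺-syntax)

-- The fractions below have denominators with constant term 1, so they are
-- evaluated in ℤ[[q]], where such denominators are invertible.  An element
-- of ℤ[[q]] is its coefficient sequence: f i is the coefficient of qⁱ.
Series : Set
Series = ℕ → ℤ

infixl 7 _⊛_ _/[1-q^_]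
infix  8 q^_ 1-q^_

q^_ : ℕ → Series
(q^ k) i = if k ℕ.≡ᵇ i then 1ℤ else 0ℤ

1-q^_ : ℕ → Series
(1-q^ k) i = (q^ 0) i - (q^ k) i

_⊛_ : Series → Series → Series
(f ⊛ g) i = ∑[ j ≤ i ] (f (toℕ j) * g (i ∸ toℕ j))

∏ : ∀ {m} → Vector Series m → Series
∏ = foldr _⊛_ (q^ 0)

-- 1 + qᵏ + q²ᵏ + ⋯, the inverse of 1 - qᵏ for k ≥ 1.  At k = 0 the value is
-- meaningless; the fractions below only use exponents k ≥ 1.
geometric : ℕ → Series
geometric k i = if does (k ∣? i) then 1ℤ else 0ℤ

_/[1-q^_] : Series → ℕ → Series
f /[1-q^ k ] = f ⊛ geometric k

-- The Gaussian polynomial, for m ≤ n.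
gaussian : ℕ → ℕ → Series
gaussian n m = ∏ {m} λ i → (1-q^ (n ∸ toℕ i)) /[1-q^ m ∸ toℕ i ]

-- The q-Kaplansky number K_q(n,m), for 1 ≤ n and m ≤ n.
kaplansky : ℕ → ℕ → Series
kaplansky n m = (1-q^ (n ℕ.+ m)) /[1-q^ n ] ⊛ gaussian n m

-- f = Σ_{i=0}^{D} (f i) qⁱ.
PolynomialUpTo : ℕ → Series → Set
PolynomialUpTo D f = ∀ i → D ℕ.< i → f i ≡ 0ℤ

Symmetric : ℕ → Series → Set
Symmetric D f = ∀ i → i ℕ.≤ D → f i ≡ f (D ∸ i)

-- The peak is required at ⌊D/2⌋, not merely somewhere.
Unimodal : ℕ → Series → Set
Unimodal D f =
    (∀ i → i ℕ.< ℕ.⌊ D /2⌋ → f i ≤ f (ℕ.suc i))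
  × (∀ i → ℕ.⌊ D /2⌋ ℕ.≤ i → i ℕ.< D → f (ℕ.suc i) ≤ f i)

-- Put N = n - m + 1, which is even.  The coefficient of qⁱ in K_q(n,m) is
-- that of [m+N, m] - q^N [m+N-2, m-2], the dimension of the weight space of
-- weight i in the harmonic polynomials of degree m on the irreducible
-- sl₂-module with weights 0, …, N: as N is even, this module carries an
-- invariant symmetric form, whose contraction (Laplacian) commutes with sl₂.
-- The raising operator is injective on the weights below the middle, hence
-- unimodality.  Only an upper bound for the dimension of the target and a lower
-- bound for that of the source are needed: a harmonic symmetric tensor is
-- determined by its coefficients at the words not containing both 0 and N
-- (the reduced words, counted by the coefficients of K_q(n,m)), so too few of
-- these in weight i + 1 would leave an underdetermined linear system for a
-- harmonic tensor of weight i with zero image.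
module Submission where

open import Defs
open import Data.Bool.Base using (if_then_else_)
open import Data.Fin.Base as Fin using (Fin; toℕ)
open import Data.Fin.Properties using (toℕ<n)
open import Data.Integer.Base as ℤ using (ℤ; 0ℤ; 1ℤ; -1ℤ)
open import Data.Integer.Properties as ℤ using (+-identityˡ; *-zeroʳ; *-zeroˡ; i*j≡0⇒i≡0∨j≡0)
open import Data.Integer.Tactic.RingSolver using (solve-∀)
open import Data.List.Base using (List; []; _∷_; _++_; map; length)
open import Data.List.Membership.Propositional using (_∈_; _∉_; find)
open import Data.List.Membership.Propositional.Properties
  using (∈-∃++; ∈-map⁺; ∈-map⁻; ∈-++⁺ˡ; ∈-++⁺ʳ)
open import Data.List.Properties using (length-++; length-map; ∷-injectiveʳ; ≡-dec)
open import Data.List.Relation.Binary.Permutation.Propositional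
  using (_↭_; ↭-sym; ↭⇒↭ₛ; refl; prep; swap; trans)
open import Data.List.Relation.Binary.Permutation.Propositional.Properties
  using (∈-resp-↭; All-resp-↭; ↭-length; shift)
open import Data.List.Relation.Binary.Pointwise using (Pointwise-≡⇒≡)
open import Data.List.Relation.Unary.All as All using (All; []; _∷_; all?)
import Data.List.Relation.Unary.All.Properties as All
open import Data.List.Relation.Unary.AllPairs.Core using ([]; _∷_)
open import Data.List.Relation.Unary.Any using (here; there)
open import Data.List.Relation.Unary.Linked as Linked using (Linked; []; [-]; _∷_)
import Data.List.Relation.Unary.Linked.Properties as Linked
open import Data.List.Relation.Unary.Sorted.TotalOrder.Properties using (↗↭↗⇒≋)
open import Data.List.Relation.Unary.Unique.Propositional using (Unique)
import Data.List.Relation.Unary.Unique.Propositional.Properties as Unique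
open import Data.Nat.Base as ℕ using (ℕ; zero; suc; _∸_; _!; s≤s; z≤n)
open import Data.Nat.Divisibility using (_∣?_; _∣0; ∣m+n∣m⇒∣n; ∣m∣n⇒∣m+n; ∣-refl; >⇒∤)
open import Data.Nat.DivMod using (_%_; _/_; m≡m%n+[m/n]*n)
open import Data.Nat.Induction using (<-rec)
open import Data.Nat.ListAction using (sum)
open import Data.Nat.ListAction.Properties using (sum-↭)
import Data.Nat.Properties as ℕ
open import Data.Product.Base using (∃; _×_; _,_; proj₁; proj₂)
open import Data.Sum.Base using ([_,_]′; inj₁; inj₂)
open import Function.Base using (_∘_; case_of_; id)
open import Function.Bundles using (mk⇔)
open import Relation.Binary.Bundles using (DecTotalOrder)
open import Relation.Binary.Definitions using (DecidableEquality)
open import Relation.Binary.Properties.DecTotalOrder ℕ.≤-decTotalOrder using (≥-decTotalOrder)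
open import Relation.Binary.PropositionalEquality.Core as ≡
  using (_≡_; _≢_; _≗_; refl; sym; cong; cong₂; subst)
open import Relation.Binary.PropositionalEquality.Properties using (module ≡-Reasoning)
open import Relation.Nullary using (¬_; Dec; yes; no; contradiction)
open import Relation.Nullary.Decidable using (_×-dec_; dec-true; dec-false; does-⇔)

open import Algebra.Properties.CommutativeMonoid.Sum ℤ.+-0-commutativeMonoid using (∑-distrib-+)
open import Algebra.Properties.Monoid.Sum ℤ.+-0-monoid
  using (sum⁺-syntax; sum-cong-≗) renaming (sum to ∑)
open import Data.List.Membership.DecPropositional ℕ._≟_ using (_∈?_)
open import Data.List.Sort ≥-decTotalOrder using (sort; sort-↭; sort-↗)

-- Integer linear functionals and underdetermined homogeneous systems

module LinearSystems where

  open import Data.Integer.Base using (_+_; _*_; _-_; -_)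
  open ≡-Reasoning

  -- Congruence is a law of its own because pointwise equal assignments need not be propositionally
  -- equal functions.
  record Linear {A : Set} (φ : (A → ℤ) → ℤ) : Set where
    field
      cong-≗ : ∀ {x y} → (∀ a → x a ≡ y a) → φ x ≡ φ y
      combine : ∀ c d x y → φ (λ a → c * x a + d * y a) ≡ c * φ x + d * φ y

  open Linear public

  module _ {A : Set} (_≟_ : DecidableEquality A) where

    δ : A → A → ℤ
    δ b a with b ≟ a
    ... | yes _ = 1ℤ
    ... | no  _ = 0ℤ

    δ-refl : ∀ b → δ b b ≡ 1ℤ
    δ-refl b with b ≟ b
    ... | yes _ = refl
    ... | no b≢b = contradiction refl b≢b

    δ-≢ : ∀ {b a} → b ≢ a → δ b a ≡ 0ℤ
    δ-≢ {b} {a} b≢a with b ≟ a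
    ... | yes b≡a = contradiction b≡a b≢a
    ... | no _ = refl

    module _ (b : A) (p : (A → ℤ) → ℤ) where

      -- Cross-multiplication with the pivot p: the value at `δ b` cancels without dividing in ℤ.
      eliminate : ((A → ℤ) → ℤ) → (A → ℤ) → ℤ
      eliminate φ y = p (δ b) * φ y - φ (δ b) * p y

      -- The multiple of `δ b` is chosen so that the pivot equation holds: p takes the value p (δ b)
      -- · p y - p y · p (δ b) = 0 here.
      backSubstitute : (A → ℤ) → A → ℤ
      backSubstitute y a = p (δ b) * y a + - p y * δ b a

      eliminate-linear : ∀ {φ} → Linear p → Linear φ → Linear (eliminate φ)
      eliminate-linear {φ} P Φ .cong-≗ x≗y =
        cong₂ (λ s t → p (δ b) * s - φ (δ b) * t) (Φ .cong-≗ x≗y) (P .cong-≗ x≗y)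
      eliminate-linear {φ} P Φ .combine c d x y =
        ≡.trans (cong₂ (λ s t → p (δ b) * s - φ (δ b) * t) (Φ .combine c d x y) (P .combine c d x y))
              (regroup (p (δ b)) (φ (δ b)) c d (φ x) (φ y) (p x) (p y))
        where
        regroup : ∀ s t c d u v u′ v′ →
                  s * (c * u + d * v) - t * (c * u′ + d * v′) ≡
                  c * (s * u - t * u′) + d * (s * v - t * v′)
        regroup = solve-∀

      apply-backSubstitute : ∀ {φ} → Linear φ → ∀ y → φ (backSubstitute y) ≡ eliminate φ y
      apply-backSubstitute {φ} Φ y =
        ≡.trans (Φ .combine (p (δ b)) (- p y) y (δ b)) (regroup (p (δ b)) (p y) (φ y) (φ (δ b)))
        where
        regroup : ∀ s t u v → s * u + - t * v ≡ s * u - v * t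
        regroup = solve-∀

    SupportedOn : List A → (A → ℤ) → Set
    SupportedOn as x = ∀ {a} → a ∉ as → x a ≡ 0ℤ

    -- Fraction-free Gaussian elimination: a pivot equation with p (δ b) ≢ 0
    -- removes the unknown b from all other equations.
    underdetermined :
      ∀ as → Unique as → ∀ φs → All Linear φs → length φs ℕ.< length as →
      ∃ λ x → SupportedOn as x × (∃ λ a → a ∈ as × x a ≢ 0ℤ) × All (λ φ → φ x ≡ 0ℤ) φs
    underdetermined (b ∷ as) (b∉as ∷ uniq) φs lin φs<as with All.all? (λ φ → φ (δ b) ℤ.≟ 0ℤ) φs
    -- Every equation holds at the unit vector `δ b`, so it is itself a nonzero solution.
    ... | yes vanish =
      δ b , (λ a∉ → δ-≢ λ { refl → a∉ (here refl) }) ,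
      (b , here refl , λ δ≡0 → case ≡.trans (sym (δ-refl b)) δ≡0 of λ ()) , vanish
    ... | no ¬vanish
      with p , p∈φs , p≢0 ← find (All.¬All⇒Any¬ (λ φ → φ (δ b) ℤ.≟ 0ℤ) φs ¬vanish)
      with φs₁ , φs₂ , refl ← ∈-∃++ p∈φs
      with lin₁ , P ∷ lin₂ ← All.++⁻ φs₁ lin
      with y , supp , (a , a∈as , ya≢0) , zeros ←
        underdetermined as uniq (map (eliminate b p) (φs₁ ++ φs₂))
          (All.map⁺ (All.map (eliminate-linear b p P) (All.++⁺ lin₁ lin₂)))
          (ℕ.≤-trans (ℕ.≤-reflexive (≡.trans (cong suc (≡.trans (length-map (eliminate b p) (φs₁ ++ φs₂)) (length-++ φs₁)))
              (≡.trans (sym (ℕ.+-suc (length φs₁) (length φs₂))) (sym (length-++ φs₁)))))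
            (ℕ.s≤s⁻¹ φs<as))
      with zeros₁ , zeros₂ ← All.++⁻ φs₁ (All.map⁻ {xs = φs₁ ++ φs₂} zeros) =
      x , x-supp , (a , there a∈as , xa≢0) ,
      All.++⁺ (solves lin₁ zeros₁) (≡.trans (apply-backSubstitute b p P y) (ℤ.+-inverseʳ (p (δ b) * p y))
        ∷ solves lin₂ zeros₂)
      where
      x = backSubstitute b p y

      solves : ∀ {φs} → All Linear φs → All (λ φ → eliminate b p φ y ≡ 0ℤ) φs → All (λ φ → φ x ≡ 0ℤ) φs
      solves [] [] = []
      solves (Φ ∷ lin) (e ∷ es) = ≡.trans (apply-backSubstitute b p Φ y) e ∷ solves lin es

      at-≢ : ∀ {a} → b ≢ a → x a ≡ p (δ b) * y a
      at-≢ {a} b≢a = begin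
        p (δ b) * y a + - p y * δ b a  ≡⟨ cong (λ d → p (δ b) * y a + - p y * d) (δ-≢ b≢a) ⟩
        p (δ b) * y a + - p y * 0ℤ     ≡⟨ cong (p (δ b) * y a +_) (*-zeroʳ (- p y)) ⟩
        p (δ b) * y a + 0ℤ             ≡⟨ ℤ.+-identityʳ _ ⟩
        p (δ b) * y a                  ∎

      x-supp : SupportedOn (b ∷ as) x
      x-supp {a} a∉ = ≡.trans (at-≢ λ { refl → a∉ (here refl) })
        (≡.trans (cong (p (δ b) *_) (supp (a∉ ∘ there))) (*-zeroʳ (p (δ b))))

      b≢a : b ≢ a
      b≢a = All.lookup b∉as a∈as

      xa≢0 : x a ≢ 0ℤ
      xa≢0 xa≡0 = [ p≢0 , ya≢0 ]′ (i*j≡0⇒i≡0∨j≡0 (p (δ b)) (≡.trans (sym (at-≢ b≢a)) xa≡0))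

  module _ {A : Set} {φ : (A → ℤ) → ℤ} (Φ : Linear φ) where

    linear-scale : ∀ c x → φ (λ a → c * x a) ≡ c * φ x
    linear-scale c x = begin
      φ (λ a → c * x a)             ≡⟨ Φ .cong-≗ (λ a → pad c (x a)) ⟩
      φ (λ a → c * x a + 0ℤ * x a)  ≡⟨ Φ .combine c 0ℤ x x ⟩
      c * φ x + 0ℤ * φ x            ≡⟨ sym (pad c (φ x)) ⟩
      c * φ x                       ∎
      where
      pad : ∀ c u → c * u ≡ c * u + 0ℤ * u
      pad = solve-∀

    linear-+ : ∀ x y → φ (λ a → x a + y a) ≡ φ x + φ y
    linear-+ x y = begin
      φ (λ a → x a + y a)            ≡⟨ Φ .cong-≗ (λ a → pad (x a) (y a)) ⟩
      φ (λ a → 1ℤ * x a + 1ℤ * y a)  ≡⟨ Φ .combine 1ℤ 1ℤ x y ⟩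
      1ℤ * φ x + 1ℤ * φ y            ≡⟨ sym (pad (φ x) (φ y)) ⟩
      φ x + φ y                      ∎
      where
      pad : ∀ u v → u + v ≡ 1ℤ * u + 1ℤ * v
      pad = solve-∀

    linear-0 : ∀ {x} → (∀ a → x a ≡ 0ℤ) → φ x ≡ 0ℤ
    linear-0 {x} x≗0 = ≡.trans (Φ .cong-≗ x≗0) (linear-scale 0ℤ (λ _ → 0ℤ))

    linear-∑ : ∀ {n} (c : Fin n → ℤ) (x : Fin n → A → ℤ) →
               φ (λ a → ∑ (λ j → c j * x j a)) ≡ ∑ (λ j → c j * φ (x j))
    linear-∑ {zero} c x = linear-0 (λ _ → refl)
    linear-∑ {suc n} c x = ≡.trans (linear-+ _ _)
      (cong₂ _+_ (linear-scale (c Fin.zero) (x Fin.zero)) (linear-∑ (c ∘ Fin.suc) (x ∘ Fin.suc)))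

  linear-- : ∀ {A : Set} {φ : (A → ℤ) → ℤ} → Linear φ → ∀ x y → φ (λ a → x a - y a) ≡ φ x - φ y
  linear-- {φ = φ} Φ x y = begin
    φ (λ a → x a - y a)               ≡⟨ Φ .cong-≗ (λ a → as-combination (x a) (y a)) ⟩
    φ (λ a → 1ℤ * x a + -1ℤ * y a)    ≡⟨ Φ .combine 1ℤ -1ℤ x y ⟩
    1ℤ * φ x + -1ℤ * φ y              ≡⟨ as-combination (φ x) (φ y) ⟨
    φ x - φ y                         ∎
    where
    as-combination : ∀ u v → u - v ≡ 1ℤ * u + -1ℤ * v
    as-combination = solve-∀

  eval-linear : ∀ {A : Set} (a : A) → Linear (λ x → x a)
  eval-linear a = record { cong-≗ = λ x≗y → x≗y a ; combine = λ _ _ _ _ → refl }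

  0-linear : ∀ {A : Set} → Linear {A} (λ _ → 0ℤ)
  0-linear = record
    { cong-≗ = λ _ → refl ; combine = λ c d _ _ → sym (cong₂ _+_ (*-zeroʳ c) (*-zeroʳ d)) }

  *-linear : ∀ {A : Set} {φ : (A → ℤ) → ℤ} k → Linear φ → Linear (λ x → k * φ x)
  *-linear {φ = φ} k Φ = record
    { cong-≗ = λ x≗y → cong (k *_) (Φ .cong-≗ x≗y)
    ; combine = λ c d x y → ≡.trans (cong (k *_) (Φ .combine c d x y)) (regroup k c d (φ x) (φ y)) }
    where
    regroup : ∀ k c d u v → k * (c * u + d * v) ≡ c * (k * u) + d * (k * v)
    regroup = solve-∀

  *-linearʳ : ∀ {A : Set} {φ : (A → ℤ) → ℤ} k → Linear φ → Linear (λ x → φ x * k)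
  *-linearʳ {φ = φ} k Φ = record
    { cong-≗ = λ x≗y → cong (_* k) (Φ .cong-≗ x≗y)
    ; combine = λ c d x y → ≡.trans (cong (_* k) (Φ .combine c d x y)) (regroup k c d (φ x) (φ y)) }
    where
    regroup : ∀ k c d u v → (c * u + d * v) * k ≡ c * (u * k) + d * (v * k)
    regroup = solve-∀

  +-linear : ∀ {A : Set} {φ ψ : (A → ℤ) → ℤ} → Linear φ → Linear ψ → Linear (λ x → φ x + ψ x)
  +-linear {φ = φ} {ψ} Φ Ψ = record
    { cong-≗ = λ x≗y → cong₂ _+_ (Φ .cong-≗ x≗y) (Ψ .cong-≗ x≗y)
    ; combine = λ c d x y → ≡.trans (cong₂ _+_ (Φ .combine c d x y) (Ψ .combine c d x y))
                                    (regroup c d (φ x) (φ y) (ψ x) (ψ y)) }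
    where
    regroup : ∀ c d u v u′ v′ → c * u + d * v + (c * u′ + d * v′) ≡ c * (u + u′) + d * (v + v′)
    regroup = solve-∀

  ∑-linear : ∀ {A : Set} {n} (φ : Fin n → (A → ℤ) → ℤ) → (∀ j → Linear (φ j)) → Linear (λ x → ∑ (λ j → φ j x))
  ∑-linear {n = zero} φ Φ = 0-linear
  ∑-linear {n = suc n} φ Φ = +-linear (Φ Fin.zero) (∑-linear (φ ∘ Fin.suc) (Φ ∘ Fin.suc))

  precompose-linear : ∀ {A B : Set} {φ : (A → ℤ) → ℤ} (h : A → B) → Linear φ → Linear (λ x → φ (x ∘ h))
  precompose-linear h Φ = record
    { cong-≗ = λ x≗y → Φ .cong-≗ (x≗y ∘ h) ; combine = λ c d x y → Φ .combine c d (x ∘ h) (y ∘ h) }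

-- Tensors as functions on words, and derivations acting on them

module Tensors where

  open import Data.Integer.Base using (_+_; _*_; _-_; -_; _^_)
  open LinearSystems
  open ≡-Reasoning

  -- A word is a list of letters, and f : Tensor assigns to the word j₁ ⋯ jₘ the
  -- coefficient of x_{j₁} ⊗ ⋯ ⊗ x_{jₘ}.
  Word : Set
  Word = List ℕ

  Tensor : Set
  Tensor = Word → ℤ

  Operator : Set
  Operator = (ℕ → ℤ) → ℕ → ℤ

  -- Commuting with every linear functional on a parameter is what makes T act
  -- independently of an operator applied to other tensor factors.
  record IsLinear (T : Operator) : Set₁ where
    field
      linear : ∀ j → Linear (λ g → T g j)
      natural : ∀ {A : Set} {φ : (A → ℤ) → ℤ} → Linear φ → ∀ (G : ℕ → A → ℤ) j →
                φ (λ a → T (λ i → G i a) j) ≡ T (λ i → φ (G i)) j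

  -- The Lie algebra action on a tensor power: T acts on one factor at a time, and the results are
  -- summed.
  derive : Operator → Tensor → Tensor
  derive T f []      = 0ℤ
  derive T f (j ∷ w) = T (λ i → f (i ∷ w)) j + derive T (λ v → f (j ∷ v)) w

  Symmetrical : Tensor → Set
  Symmetrical f = ∀ {v w} → v ↭ w → f v ≡ f w

  -- If T g j reads g only at letters i with R j i, then `derive T f` at v reads f only at words w
  -- with `Step R v w`.
  data Step (R : ℕ → ℕ → Set) : Word → Word → Set where
    here  : ∀ {j i w} → R j i → Step R (j ∷ w) (i ∷ w)
    there : ∀ {j v w} → Step R v w → Step R (j ∷ v) (j ∷ w)

  step-length : ∀ {R v w} → Step R v w → length v ≡ length w
  step-length (here _)  = refl
  step-length (there s) = cong suc (step-length s)

  -- Offsets on both sides cover lowering (a = 1, b = 0) and raising (a = 0, b = 1) without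
  -- subtraction.
  step-sum : ∀ {R} a b → (∀ {j i} → R j i → a ℕ.+ j ≡ b ℕ.+ i) →
             ∀ {v w} → Step R v w → a ℕ.+ sum v ≡ b ℕ.+ sum w
  step-sum a b eq {j ∷ w} {i ∷ .w} (here r) = begin
    a ℕ.+ (j ℕ.+ sum w)  ≡⟨ sym (ℕ.+-assoc a j _) ⟩
    a ℕ.+ j ℕ.+ sum w    ≡⟨ cong (ℕ._+ sum w) (eq r) ⟩
    b ℕ.+ i ℕ.+ sum w    ≡⟨ ℕ.+-assoc b i _ ⟩
    b ℕ.+ (i ℕ.+ sum w)  ∎
  step-sum a b eq {j ∷ v} {.j ∷ w} (there s) = begin
    a ℕ.+ (j ℕ.+ sum v)  ≡⟨ ℕ-swap a j (sum v) ⟩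
    j ℕ.+ (a ℕ.+ sum v)  ≡⟨ cong (j ℕ.+_) (step-sum a b eq s) ⟩
    j ℕ.+ (b ℕ.+ sum w)  ≡⟨ sym (ℕ-swap b j (sum w)) ⟩
    b ℕ.+ (j ℕ.+ sum w)  ∎
    where
    ℕ-swap : ∀ x y z → x ℕ.+ (y ℕ.+ z) ≡ y ℕ.+ (x ℕ.+ z)
    ℕ-swap x y z = ≡.trans (sym (ℕ.+-assoc x y z)) (≡.trans (cong (ℕ._+ z) (ℕ.+-comm x y)) (ℕ.+-assoc y x z))

  derive-local : ∀ {T R} → (∀ {g j} → (∀ {i} → R j i → g i ≡ 0ℤ) → T g j ≡ 0ℤ) →
                 ∀ {f} w → (∀ {v} → Step R w v → f v ≡ 0ℤ) → derive T f w ≡ 0ℤ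
  derive-local T-local []      f≡0 = refl
  derive-local T-local (j ∷ w) f≡0 =
    cong₂ _+_ (T-local (f≡0 ∘ here)) (derive-local T-local w (f≡0 ∘ there))

  module _ {T : Operator} (isLinear : IsLinear T) where
    open IsLinear isLinear

    derive-linear : ∀ w → Linear (λ f → derive T f w)
    derive-linear []      = 0-linear
    derive-linear (j ∷ w) =
      +-linear (precompose-linear (_∷ w) (linear j)) (precompose-linear (j ∷_) (derive-linear w))

    -- A sum over all positions does not depend on their order; in the `swap` case the first two
    -- summands trade places.
    derive-sym : ∀ {f} → Symmetrical f → Symmetrical (derive T f)
    derive-sym f-sym refl = refl
    derive-sym f-sym (prep j p) =
      cong₂ _+_ (linear j .cong-≗ (λ i → f-sym (prep i p))) (derive-sym (f-sym ∘ prep j) p)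
    derive-sym {f} f-sym {_ ∷ _ ∷ v} {_ ∷ _ ∷ w} (swap j k p) = begin
      T (λ i → f (i ∷ k ∷ v)) j + (T (λ i → f (j ∷ i ∷ v)) k + derive T (λ u → f (j ∷ k ∷ u)) v)
        ≡⟨ cong₂ _+_ (linear j .cong-≗ (λ i → f-sym (swap i k p)))
          (cong₂ _+_ (linear k .cong-≗ (λ i → f-sym (swap j i p)))
            (≡.trans (derive-linear v .cong-≗ (λ u → f-sym (swap j k refl)))
                     (derive-sym (λ q → f-sym (prep k (prep j q))) p))) ⟩
      T (λ i → f (k ∷ i ∷ w)) j + (T (λ i → f (i ∷ j ∷ w)) k + derive T (λ u → f (k ∷ j ∷ u)) w)
        ≡⟨ +-exchange (T (λ i → f (k ∷ i ∷ w)) j) (T (λ i → f (i ∷ j ∷ w)) k) _ ⟩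
      T (λ i → f (i ∷ j ∷ w)) k + (T (λ i → f (k ∷ i ∷ w)) j + derive T (λ u → f (k ∷ j ∷ u)) w)  ∎
      where
      +-exchange : ∀ a b c → a + (b + c) ≡ b + (a + c)
      +-exchange = solve-∀
    derive-sym f-sym (trans p q) = ≡.trans (derive-sym f-sym p) (derive-sym f-sym q)

  weight : (ℕ → ℤ) → Word → ℤ
  weight h []      = 0ℤ
  weight h (j ∷ w) = h j + weight h w

  -- By naturality, S and T commute when they act on different factors. Only the terms with both on
  -- one factor survive, and there the commutator is diagonal with entries h.
  derive-commutator : ∀ {S T h} → IsLinear S → IsLinear T →
    (∀ g j → S (T g) j ≡ T (S g) j + h j * g j) →
    ∀ f w → derive S (derive T f) w ≡ derive T (derive S f) w + weight h w * f w
  derive-commutator S-lin T-lin [S,T] f [] = refl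
  derive-commutator {S} {T} {h} S-lin T-lin [S,T] f (j ∷ w) = begin
    S (λ i → T (f∷ w) i + derive T (λ v → f (i ∷ v)) w) j
      + derive S (λ v → T (f∷ v) j + derive T f′ v) w
      ≡⟨ cong₂ _+_ (linear-+ (S-lin .IsLinear.linear j) _ _) (linear-+ (derive-linear S-lin w) _ _) ⟩
    S (T (f∷ w)) j + S (λ i → derive T (λ v → f (i ∷ v)) w) j
      + (derive S (λ v → T (f∷ v) j) w + derive S (derive T f′) w)
      ≡⟨ cong₂ _+_ (cong₂ _+_ ([S,T] (f∷ w) j)
                     (sym (S-lin .IsLinear.natural (derive-linear T-lin w) (λ i v → f (i ∷ v)) j)))
                   (cong₂ _+_ (T-lin .IsLinear.natural (derive-linear S-lin w) (λ i v → f (i ∷ v)) j)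
                     (derive-commutator S-lin T-lin [S,T] f′ w)) ⟩
    T (S (f∷ w)) j + h j * f (j ∷ w) + derive T (λ v → S (f∷ v) j) w
      + (T (λ i → derive S (λ v → f (i ∷ v)) w) j
         + (derive T (derive S f′) w + weight h w * f (j ∷ w)))
      ≡⟨ regroup (T (S (f∷ w)) j) (h j) (f (j ∷ w)) _ _ _ (weight h w) ⟩
    T (S (f∷ w)) j + T (λ i → derive S (λ v → f (i ∷ v)) w) j
      + (derive T (λ v → S (f∷ v) j) w + derive T (derive S f′) w)
      + (h j + weight h w) * f (j ∷ w)
      ≡⟨ cong (_+ (h j + weight h w) * f (j ∷ w)) (sym
          (cong₂ _+_ (linear-+ (T-lin .IsLinear.linear j) _ _) (linear-+ (derive-linear T-lin w) _ _))) ⟩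
    T (λ i → S (f∷ w) i + derive S (λ v → f (i ∷ v)) w) j
      + derive T (λ v → S (f∷ v) j + derive S f′ v) w
      + (h j + weight h w) * f (j ∷ w)  ∎
    where
    f∷ : Word → ℕ → ℤ
    f∷ v i = f (i ∷ v)
    f′ : Tensor
    f′ v = f (j ∷ v)
    regroup : ∀ a b c d e g k → a + b * c + d + (e + (g + k * c)) ≡ a + e + (d + g) + (b + k) * c
    regroup = solve-∀

  -- The lowering and raising operators of sl₂

  push : Operator
  push g j = ℤ.+ suc j * g (suc j)

  lower : Tensor → Tensor
  lower = derive push

  push-linear : IsLinear push
  push-linear = record
    { linear  = λ j → *-linear (ℤ.+ suc j) (eval-linear (suc j))
    ; natural = λ Φ G j → linear-scale Φ (ℤ.+ suc j) (G (suc j)) }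

  push-local : ∀ {g j} → (∀ {i} → suc j ≡ i → g i ≡ 0ℤ) → push g j ≡ 0ℤ
  push-local {g} {j} g≡0 = ≡.trans (cong (ℤ.+ suc j *_) (g≡0 refl)) (*-zeroʳ (ℤ.+ suc j))

  Homogeneous : ℕ → ℕ → Tensor → Set
  Homogeneous m i f = ∀ w → ¬ (length w ≡ m × sum w ≡ i) → f w ≡ 0ℤ

  lower-homogeneous : ∀ {m i f} → Homogeneous m (suc i) f → Homogeneous m i (lower f)
  lower-homogeneous hom w off = derive-local push-local w λ s → hom _ λ (l , e) →
    off (≡.trans (step-length s) l , ℕ.suc-injective (≡.trans (step-sum 1 0 id s) e))

  lower-lowest : ∀ {m f} → Homogeneous m 0 f → ∀ w → lower f w ≡ 0ℤ
  lower-lowest hom w = derive-local push-local w λ s → hom _ λ (_ , e) →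
    case ≡.trans (step-sum 1 0 id s) e of λ ()

  module _ (N : ℕ) where

    -- Letters above N are allowed: the coefficient N - j vanishes at j = N, so
    -- raise preserves the tensors supported on words with letters at most N.
    pull : Operator
    pull g zero    = 0ℤ
    pull g (suc j) = (ℤ.+ N - ℤ.+ j) * g j

    raise : Tensor → Tensor
    raise = derive pull

    pull-linear : IsLinear pull
    pull-linear = record { linear = linear ; natural = natural }
      where
      linear : ∀ j → Linear (λ g → pull g j)
      linear zero    = 0-linear
      linear (suc j) = *-linear (ℤ.+ N - ℤ.+ j) (eval-linear j)
      natural : ∀ {A : Set} {φ : (A → ℤ) → ℤ} → Linear φ → ∀ (G : ℕ → A → ℤ) j →
                φ (λ a → pull (λ i → G i a) j) ≡ pull (λ i → φ (G i)) j
      natural Φ G zero    = linear-0 Φ (λ _ → refl)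
      natural Φ G (suc j) = linear-scale Φ (ℤ.+ N - ℤ.+ j) (G j)

    -- On the polynomial Σ (g j) tʲ, `push` is d/dt and `pull` is N t - t² d/dt. This is the sl₂
    -- relation between them, with tʲ of weight N - 2 j.
    push-pull : ∀ g j → push (pull g) j ≡ pull (push g) j + (ℤ.+ N - ℤ.+ 2 * ℤ.+ j) * g j
    push-pull g zero = identity (ℤ.+ N) (g 0)
      where
      identity : ∀ n x → 1ℤ * ((n - 0ℤ) * x) ≡ 0ℤ + (n - ℤ.+ 2 * 0ℤ) * x
      identity = solve-∀
    push-pull g (suc j) = identity (ℤ.+ N) (ℤ.+ j) (g (suc j))
      where
      identity : ∀ n j x → (ℤ.+ 2 + j) * ((n - (1ℤ + j)) * x) ≡
                           (n - j) * ((1ℤ + j) * x) + (n - ℤ.+ 2 * (1ℤ + j)) * x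
      identity = solve-∀

    pull-local : ∀ {g j} → (∀ {i} → j ≡ suc i × i ≢ N → g i ≡ 0ℤ) → pull g j ≡ 0ℤ
    pull-local {g} {zero} g≡0 = refl
    pull-local {g} {suc j} g≡0 with j ℕ.≟ N
    ... | yes refl = ≡.trans (cong (_* g j) (ℤ.+-inverseʳ (ℤ.+ j))) (*-zeroˡ (g j))
    ... | no j≢N   = ≡.trans (cong ((ℤ.+ N - ℤ.+ j) *_) (g≡0 (refl , j≢N))) (*-zeroʳ (ℤ.+ N - ℤ.+ j))

    weight-formula : ∀ w → weight (λ j → ℤ.+ N - ℤ.+ 2 * ℤ.+ j) w ≡ ℤ.+ (length w ℕ.* N) - ℤ.+ (2 ℕ.* sum w)
    weight-formula [] = refl
    weight-formula (j ∷ w) = begin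
      ℤ.+ N - ℤ.+ 2 * ℤ.+ j + weight (λ j → ℤ.+ N - ℤ.+ 2 * ℤ.+ j) w
        ≡⟨ cong (ℤ.+ N - ℤ.+ 2 * ℤ.+ j +_) (weight-formula w) ⟩
      ℤ.+ N - ℤ.+ 2 * ℤ.+ j + (ℤ.+ (length w ℕ.* N) - ℤ.+ (2 ℕ.* sum w))
        ≡⟨ cong (λ s → ℤ.+ N - ℤ.+ 2 * ℤ.+ j + (ℤ.+ (length w ℕ.* N) - s)) (ℤ.pos-* 2 (sum w)) ⟩
      ℤ.+ N - ℤ.+ 2 * ℤ.+ j + (ℤ.+ (length w ℕ.* N) - ℤ.+ 2 * ℤ.+ sum w)
        ≡⟨ identity (ℤ.+ N) (ℤ.+ j) (ℤ.+ (length w ℕ.* N)) (ℤ.+ sum w) ⟩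
      ℤ.+ N + ℤ.+ (length w ℕ.* N) - ℤ.+ 2 * (ℤ.+ j + ℤ.+ sum w)
        ≡⟨ cong (λ s → ℤ.+ N + ℤ.+ (length w ℕ.* N) - s) (sym (ℤ.pos-* 2 (j ℕ.+ sum w))) ⟩
      ℤ.+ (N ℕ.+ length w ℕ.* N) - ℤ.+ (2 ℕ.* (j ℕ.+ sum w))  ∎
      where
      identity : ∀ n j a s → n - ℤ.+ 2 * j + (a - ℤ.+ 2 * s) ≡ n + a - ℤ.+ 2 * (j + s)
      identity = solve-∀

    -- All words in the support of f have the same weight d = m N - 2 i, so the commutator acts on f
    -- as a scalar. The hypothesis states d additively to avoid truncated subtraction.
    lower-raise : ∀ {m i f} d → 2 ℕ.* i ℕ.+ d ≡ m ℕ.* N → Homogeneous m i f →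
                  ∀ w → lower (raise f) w ≡ raise (lower f) w + ℤ.+ d * f w
    lower-raise {m} {i} {f} d 2i+d≡mN hom w = ≡.trans
      (derive-commutator push-linear pull-linear push-pull f w)
      (cong (raise (lower f) w +_) (≡.trans (cong (_* f w) (weight-formula w)) eigenvalue))
      where
      eigenvalue : (ℤ.+ (length w ℕ.* N) - ℤ.+ (2 ℕ.* sum w)) * f w ≡ ℤ.+ d * f w
      eigenvalue with (length w ℕ.≟ m) ×-dec (sum w ℕ.≟ i)
      ... | yes (refl , refl) = cong (_* f w) (begin
        ℤ.+ (length w ℕ.* N) - ℤ.+ (2 ℕ.* sum w)      ≡⟨ cong (λ x → ℤ.+ x - ℤ.+ (2 ℕ.* sum w)) (sym 2i+d≡mN) ⟩
        ℤ.+ (2 ℕ.* sum w) + ℤ.+ d - ℤ.+ (2 ℕ.* sum w) ≡⟨ cancel (ℤ.+ (2 ℕ.* sum w)) (ℤ.+ d) ⟩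
        ℤ.+ d                                         ∎)
        where
        cancel : ∀ a b → a + b - a ≡ b
        cancel = solve-∀
      ... | no off rewrite hom w off =
        ≡.trans (*-zeroʳ (ℤ.+ (length w ℕ.* N) - ℤ.+ (2 ℕ.* sum w))) (sym (*-zeroʳ (ℤ.+ d)))

    -- The eigenvalues of lower ∘ raise on the homogeneous part of weight i are
    -- sums of the positive numbers m N - 2 i′ with i′ ≤ i.
    eigenvector-vanishes : ∀ {m} i {f} c → 2 ℕ.* i ℕ.< m ℕ.* N → Homogeneous m i f →
      (∀ w → lower (raise f) w ≡ - (ℤ.+ c) * f w) → ∀ w → f w ≡ 0ℤ
    raise-lower-injective : ∀ {m} i {f} c → 2 ℕ.* i ℕ.< m ℕ.* N → Homogeneous m i f →
      (∀ w → raise (lower f) w ≡ - (ℤ.+ suc c) * f w) → ∀ w → f w ≡ 0ℤ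

    -- Exchanging the operators turns the eigenvalue -c into -(c + m N - 2 i), which is strictly
    -- negative even for c = 0.
    eigenvector-vanishes {m} i {f} c 2i<mN hom eigen = raise-lower-injective i (c ℕ.+ d) 2i<mN hom λ w → begin
      raise (lower f) w                                      ≡⟨ cancel (raise (lower f) w) (ℤ.+ suc d * f w) ⟩
      raise (lower f) w + ℤ.+ suc d * f w - ℤ.+ suc d * f w
        ≡⟨ cong (_- ℤ.+ suc d * f w) (lower-raise (suc d) 2i+d≡mN hom w) ⟨
      lower (raise f) w - ℤ.+ suc d * f w                    ≡⟨ cong (_- ℤ.+ suc d * f w) (eigen w) ⟩
      - (ℤ.+ c) * f w - ℤ.+ suc d * f w                      ≡⟨ collect (ℤ.+ c) (ℤ.+ d) (f w) ⟩
      - (ℤ.+ suc (c ℕ.+ d)) * f w                            ∎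
      where
      d = m ℕ.* N ∸ suc (2 ℕ.* i)
      2i+d≡mN : 2 ℕ.* i ℕ.+ suc d ≡ m ℕ.* N
      2i+d≡mN = ≡.trans (ℕ.+-suc (2 ℕ.* i) d) (ℕ.m+[n∸m]≡n 2i<mN)
      cancel : ∀ a b → a ≡ a + b - b
      cancel = solve-∀
      collect : ∀ c d x → - c * x - (1ℤ + d) * x ≡ - (1ℤ + (c + d)) * x
      collect = solve-∀

    raise-lower-injective i {f} c 2i<mN hom eigen = λ w →
      [ (λ ()) , id ]′ (i*j≡0⇒i≡0∨j≡0 (- (ℤ.+ suc c))
        (≡.trans (sym (eigen w)) (linear-0 (derive-linear pull-linear w) (lower≡0 i 2i<mN hom))))
      where
      lower≡0 : ∀ i → 2 ℕ.* i ℕ.< _ → Homogeneous _ i f → ∀ w → lower f w ≡ 0ℤ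
      lower≡0 zero    _      hom = lower-lowest hom
      -- Applying `lower` to the eigenvalue equation makes `lower f` an eigenvector of
      -- `lower ∘ raise`, one weight further down and with the same eigenvalue.
      lower≡0 (suc i) 2i<mN hom = eigenvector-vanishes i (suc c)
        (ℕ.≤-<-trans (ℕ.*-monoʳ-≤ 2 (ℕ.n≤1+n i)) 2i<mN) (lower-homogeneous hom)
        λ w → ≡.trans (derive-linear push-linear w .cong-≗ eigen)
                      (linear-scale (derive-linear push-linear w) (- (ℤ.+ suc c)) f)

    -- The case of eigenvalue 0: if `raise f` vanishes, so does `lower (raise f)`.
    raise-injective : ∀ {m} i {f} → 2 ℕ.* i ℕ.< m ℕ.* N → Homogeneous m i f →
                      (∀ w → raise f w ≡ 0ℤ) → ∀ w → f w ≡ 0ℤ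
    raise-injective i 2i<mN hom raise≡0 = eigenvector-vanishes i 0 2i<mN hom λ w →
      linear-0 (derive-linear push-linear w) raise≡0

  -- Contraction with the invariant form, and harmonic tensors

  ∑-telescope : ∀ n (A B : ℕ → ℤ) → (∀ {a} → a ℕ.< n → A (suc a) + B a ≡ 0ℤ) →
                ∑[ j ≤ n ] (A (toℕ j) + B (toℕ j)) ≡ A 0 + B n
  ∑-telescope zero    A B cancel = ℤ.+-identityʳ (A 0 + B 0)
  ∑-telescope (suc n) A B cancel = begin
    A 0 + B 0 + ∑[ j ≤ n ] (A (suc (toℕ j)) + B (suc (toℕ j)))
      ≡⟨ cong (A 0 + B 0 +_) (∑-telescope n (A ∘ suc) (B ∘ suc) (cancel ∘ s≤s)) ⟩
    A 0 + B 0 + (A 1 + B (suc n))  ≡⟨ regroup (A 0) (B 0) (A 1) (B (suc n)) ⟩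
    A 0 + (A 1 + B 0) + B (suc n)  ≡⟨ cong (λ x → A 0 + x + B (suc n)) (cancel (s≤s z≤n)) ⟩
    A 0 + 0ℤ + B (suc n)           ≡⟨ cong (_+ B (suc n)) (ℤ.+-identityʳ (A 0)) ⟩
    A 0 + B (suc n)                ∎
    where
    regroup : ∀ a b c d → a + b + (c + d) ≡ a + (c + b) + d
    regroup = solve-∀

  ∑-last : ∀ n (F : ℕ → ℤ) → (∀ {a} → a ℕ.< n → F a ≡ 0ℤ) → ∑[ j ≤ n ] F (toℕ j) ≡ F n
  ∑-last zero    F F≡0 = ℤ.+-identityʳ (F 0)
  ∑-last (suc n) F F≡0 = ≡.trans
    (cong₂ _+_ (F≡0 (s≤s z≤n)) (∑-last n (F ∘ suc) (F≡0 ∘ s≤s))) (+-identityˡ (F (suc n)))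

  ∑≡0 : ∀ {n} (c : Fin n → ℤ) {t : Fin n → ℤ} → (∀ j → t j ≡ 0ℤ) → ∑ (λ j → c j * t j) ≡ 0ℤ
  ∑≡0 {zero} c t≡0 = refl
  ∑≡0 {suc n} c t≡0 = cong₂ _+_ (≡.trans (cong (c Fin.zero *_) (t≡0 Fin.zero)) (*-zeroʳ (c Fin.zero)))
    (∑≡0 (c ∘ Fin.suc) (t≡0 ∘ Fin.suc))

  zeros : Word → ℕ
  zeros []          = 0
  zeros (zero ∷ w)  = suc (zeros w)
  zeros (suc _ ∷ w) = zeros w

  zeros-↭ : ∀ {v w} → v ↭ w → zeros v ≡ zeros w
  zeros-↭ refl                         = refl
  zeros-↭ (prep zero p)                = cong suc (zeros-↭ p)
  zeros-↭ (prep (suc _) p)             = zeros-↭ p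
  zeros-↭ (swap zero zero p)           = cong (2 ℕ.+_) (zeros-↭ p)
  zeros-↭ (swap zero (suc _) p)        = cong suc (zeros-↭ p)
  zeros-↭ (swap (suc _) zero p)        = cong suc (zeros-↭ p)
  zeros-↭ (swap (suc _) (suc _) p)     = zeros-↭ p
  zeros-↭ (trans p q)                  = ≡.trans (zeros-↭ p) (zeros-↭ q)

  ∈-↭∷ : ∀ {A : Set} {x : A} {xs} → x ∈ xs → ∃ λ ys → xs ↭ x ∷ ys
  ∈-↭∷ x∈xs with ys , zs , refl ← ∈-∃++ x∈xs = ys ++ zs , shift _ ys zs

  -1^-even : ∀ h → -1ℤ ^ (h ℕ.+ h) ≡ 1ℤ
  -1^-even zero    = refl
  -1^-even (suc h) rewrite ℕ.+-suc h h | -1^-even h = refl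

  module _ (N : ℕ) where

    -- The invariant quadratic form Σ (-1)ʲ (N choose j) xⱼ x_{N-j}, in the dual
    -- basis and scaled to be integral.
    form : ℕ → ℤ
    form a = -1ℤ ^ a * ℤ.+ (a ! ℕ.* (N ∸ a) !)

    -- The form is paired with the first two factors; for a symmetric tensor any other two would
    -- give the same result.
    contract : Tensor → Tensor
    contract f w = ∑[ j ≤ N ] (form (toℕ j) * f (toℕ j ∷ N ∸ toℕ j ∷ w))

    contract-linear : ∀ w → Linear (λ f → contract f w)
    contract-linear w = ∑-linear {n = suc N} (λ j f → form (toℕ j) * f (toℕ j ∷ N ∸ toℕ j ∷ w))
      λ j → *-linear (form (toℕ j)) (eval-linear (toℕ j ∷ N ∸ toℕ j ∷ w))

    contract-sym : ∀ {f} → Symmetrical f → Symmetrical (contract f)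
    contract-sym f-sym p = sum-cong-≗ {suc N} λ j →
      cong (form (toℕ j) *_) (f-sym (prep (toℕ j) (prep (N ∸ toℕ j) p)))

    contract-local : ∀ {f} w → (∀ {j} → j ℕ.≤ N → f (j ∷ N ∸ j ∷ w) ≡ 0ℤ) → contract f w ≡ 0ℤ
    contract-local w f≡0 = ∑≡0 {suc N} (form ∘ toℕ) λ j → f≡0 (ℕ.s≤s⁻¹ (toℕ<n j))

    module _ {a} (a<N : a ℕ.< N) where
      private b = N ∸ suc a

      N∸a : N ∸ a ≡ suc b
      N∸a = ℕ.+-∸-assoc 1 a<N

      N-a : ℤ.+ N - ℤ.+ a ≡ ℤ.+ suc b
      N-a = ≡.trans (ℤ.m-n≡m⊖n N a) (≡.trans (ℤ.⊖-≥ (ℕ.<⇒≤ a<N)) (cong ℤ.+_ N∸a))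

      N-b : ℤ.+ N - ℤ.+ b ≡ ℤ.+ suc a
      N-b = ≡.trans (ℤ.m-n≡m⊖n N b) (≡.trans (ℤ.⊖-≥ (ℕ.m∸n≤m N (suc a))) (cong ℤ.+_ (ℕ.m∸[m∸n]≡n a<N)))

      -- With a + b + 1 = N, both products have absolute value (a + 1)! (b + 1)!, and their signs
      -- are opposite.
      form-invariant : form (suc a) * ℤ.+ suc b + form a * ℤ.+ suc a ≡ 0ℤ
      form-invariant = begin
        -1ℤ * s * ℤ.+ (suc a ! ℕ.* b !) * ℤ.+ suc b + s * ℤ.+ (a ! ℕ.* (N ∸ a) !) * ℤ.+ suc a
          ≡⟨ cong (λ n → -1ℤ * s * ℤ.+ (suc a ! ℕ.* b !) * ℤ.+ suc b + s * ℤ.+ (a ! ℕ.* n !) * ℤ.+ suc a) N∸a ⟩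
        -1ℤ * s * ℤ.+ (suc a ℕ.* a ! ℕ.* b !) * ℤ.+ suc b + s * ℤ.+ (a ! ℕ.* (suc b ℕ.* b !)) * ℤ.+ suc a
          ≡⟨ cong₂ (λ x y → -1ℤ * s * x * ℤ.+ suc b + s * y * ℤ.+ suc a)
               (≡.trans (ℤ.pos-* (suc a ℕ.* a !) (b !)) (cong (_* ℤ.+ (b !)) (ℤ.pos-* (suc a) (a !))))
               (≡.trans (ℤ.pos-* (a !) (suc b ℕ.* b !)) (cong (ℤ.+ (a !) *_) (ℤ.pos-* (suc b) (b !)))) ⟩
        -1ℤ * s * (ℤ.+ suc a * ℤ.+ (a !) * ℤ.+ (b !)) * ℤ.+ suc b + s * (ℤ.+ (a !) * (ℤ.+ suc b * ℤ.+ (b !))) * ℤ.+ suc a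
          ≡⟨ identity s (ℤ.+ suc a) (ℤ.+ suc b) (ℤ.+ (a !)) (ℤ.+ (b !)) ⟩
        0ℤ  ∎
        where
        s = -1ℤ ^ a
        identity : ∀ s a b a! b! → -1ℤ * s * (a * a! * b!) * b + s * (a! * (b * b!)) * a ≡ 0ℤ
        identity = solve-∀

    -- Raising a factor that is not contracted commutes with the contraction. The terms that raise
    -- one of the two contracted factors telescope to zero, because the form is invariant.
    contract-raise : ∀ f w → contract (raise N f) w ≡ raise N (contract f) w
    contract-raise f w = begin
      ∑[ j ≤ N ] (form (toℕ j) * raise N f (toℕ j ∷ N ∸ toℕ j ∷ w))
        ≡⟨ sum-cong-≗ {suc N} (λ j → distribute (form (toℕ j)) (first (toℕ j)) (second (toℕ j)) (rest (toℕ j))) ⟩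
      ∑[ j ≤ N ] (A (toℕ j) + B (toℕ j) + form (toℕ j) * rest (toℕ j))
        ≡⟨ ∑-distrib-+ {suc N} (λ j → A (toℕ j) + B (toℕ j)) (λ j → form (toℕ j) * rest (toℕ j)) ⟩
      ∑[ j ≤ N ] (A (toℕ j) + B (toℕ j)) + ∑[ j ≤ N ] (form (toℕ j) * rest (toℕ j))
        ≡⟨ cong₂ _+_ boundary (sym (linear-∑ (derive-linear (pull-linear N) w) {suc N} (form ∘ toℕ)
                                     (λ j v → f (toℕ j ∷ N ∸ toℕ j ∷ v)))) ⟩
      0ℤ + raise N (contract f) w
        ≡⟨ +-identityˡ _ ⟩
      raise N (contract f) w  ∎
      where
      first second rest A B : ℕ → ℤ
      first j  = pull N (λ i → f (i ∷ N ∸ j ∷ w)) j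
      second j = pull N (λ i → f (j ∷ i ∷ w)) (N ∸ j)
      rest j   = raise N (λ v → f (j ∷ N ∸ j ∷ v)) w
      A j = form j * first j
      B j = form j * second j

      distribute : ∀ q x y z → q * (x + (y + z)) ≡ q * x + q * y + q * z
      distribute = solve-∀

      cancel : ∀ {a} → a ℕ.< N → A (suc a) + B a ≡ 0ℤ
      cancel {a} a<N = begin
        form (suc a) * ((ℤ.+ N - ℤ.+ a) * x) + form a * pull N (λ i → f (a ∷ i ∷ w)) (N ∸ a)
          ≡⟨ cong₂ (λ c k → form (suc a) * (c * x) + form a * pull N (λ i → f (a ∷ i ∷ w)) k) (N-a a<N) (N∸a a<N) ⟩
        form (suc a) * (ℤ.+ suc b * x) + form a * ((ℤ.+ N - ℤ.+ b) * x)
          ≡⟨ cong (λ c → form (suc a) * (ℤ.+ suc b * x) + form a * (c * x)) (N-b a<N) ⟩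
        form (suc a) * (ℤ.+ suc b * x) + form a * (ℤ.+ suc a * x)
          ≡⟨ factor (form (suc a)) (ℤ.+ suc b) (form a) (ℤ.+ suc a) x ⟩
        (form (suc a) * ℤ.+ suc b + form a * ℤ.+ suc a) * x
          ≡⟨ cong (_* x) (form-invariant a<N) ⟩
        0ℤ * x  ≡⟨ *-zeroˡ x ⟩
        0ℤ      ∎
        where
        b = N ∸ suc a
        x = f (a ∷ b ∷ w)
        factor : ∀ p b q a x → p * (b * x) + q * (a * x) ≡ (p * b + q * a) * x
        factor = solve-∀

      -- Both end terms contain `pull` evaluated at the letter 0, which is zero.
      boundary : ∑[ j ≤ N ] (A (toℕ j) + B (toℕ j)) ≡ 0ℤ
      boundary = ≡.trans (∑-telescope N A B cancel) (cong₂ _+_ (*-zeroʳ (form 0))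
        (≡.trans (cong (λ k → form N * pull N (λ i → f (N ∷ i ∷ w)) k) (ℕ.n∸n≡0 N)) (*-zeroʳ (form N))))

  module _ (h : ℕ) where
    private N = suc h ℕ.+ suc h

    -- The evenness of N enters here: both extreme coefficients equal N!, whereas for odd N they
    -- would cancel.
    form-0+N : form N 0 + form N N ≢ 0ℤ
    form-0+N eq = contradiction (ℤ.+-injective (≡.trans (sym value) eq))
      (ℕ.m<n⇒n≢0 (ℕ.≤-trans (ℕ.1≤n! N) (ℕ.m≤m+n (N !) (N !))))
      where
      value : form N 0 + form N N ≡ ℤ.+ (N ! ℕ.+ N !)
      value = begin
        1ℤ * ℤ.+ (1 ℕ.* N !) + -1ℤ ^ N * ℤ.+ (N ! ℕ.* (N ∸ N) !)
          ≡⟨ cong₂ (λ s k → 1ℤ * ℤ.+ (1 ℕ.* N !) + s * ℤ.+ (N ! ℕ.* k !)) (-1^-even (suc h)) (ℕ.n∸n≡0 N) ⟩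
        1ℤ * ℤ.+ (1 ℕ.* N !) + 1ℤ * ℤ.+ (N ! ℕ.* 1)
          ≡⟨ cong₂ _+_ (ℤ.*-identityˡ (ℤ.+ (1 ℕ.* N !))) (ℤ.*-identityˡ (ℤ.+ (N ! ℕ.* 1))) ⟩
        ℤ.+ (1 ℕ.* N !) + ℤ.+ (N ! ℕ.* 1)
          ≡⟨ cong₂ (λ x y → ℤ.+ x + ℤ.+ y) (ℕ.*-identityˡ (N !)) (ℕ.*-identityʳ (N !)) ⟩
        ℤ.+ (N ! ℕ.+ N !)  ∎

    -- Contraction expresses the coefficient at 0, N, u through coefficients with
    -- fewer zeros.
    harmonic-determined : ∀ {g} → Symmetrical g → (∀ w → contract N g w ≡ 0ℤ) →
      (∀ w → ¬ (0 ∈ w × N ∈ w) → g w ≡ 0ℤ) → ∀ w → g w ≡ 0ℤ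
    harmonic-determined {g} g-sym harmonic reduced w = go (zeros w) w ℕ.≤-refl
      where
      go : ∀ k w → zeros w ℕ.≤ k → g w ≡ 0ℤ
      go k w zeros≤k with (0 ∈? w) ×-dec (N ∈? w)
      ... | no ¬both = reduced w ¬both
      ... | yes (0∈w , N∈w) with v , w↭0∷v ← ∈-↭∷ 0∈w with ∈-resp-↭ w↭0∷v N∈w
      ... | there N∈v with u , v↭N∷u ← ∈-↭∷ N∈v = below k (subst (ℕ._≤ k) (zeros-↭ w↭0Nu) zeros≤k)
        where
        w↭0Nu : w ↭ 0 ∷ N ∷ u
        w↭0Nu = trans w↭0∷v (prep 0 v↭N∷u)

        below : ∀ k → suc (zeros u) ℕ.≤ k → g w ≡ 0ℤ
        -- By symmetry the terms j = 0 and j = N of the contraction carry the same coefficient x. In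
        -- between, both j and N - j are positive, so those words have fewer zeros and the induction
        -- applies.
        below (suc k) (s≤s zu≤k) =
          ≡.trans (g-sym w↭0Nu) ([ (λ e → contradiction e form-0+N) , id ]′ (i*j≡0⇒i≡0∨j≡0 (form N 0 + form N N) (begin
            (form N 0 + form N N) * x                ≡⟨ ℤ.*-distribʳ-+ x (form N 0) (form N N) ⟩
            form N 0 * x + form N N * x
              ≡⟨ cong (λ y → form N 0 * x + form N N * y) (g-sym (swap 0 N refl)) ⟩
            form N 0 * x + form N N * g (N ∷ 0 ∷ u)
              ≡⟨ cong (λ z → form N 0 * x + form N N * g (N ∷ z ∷ u)) (ℕ.n∸n≡0 N) ⟨
            form N 0 * x + F N
              ≡⟨ cong (form N 0 * x +_) (∑-last (h ℕ.+ suc h) (F ∘ suc) middle) ⟨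
            contract N g u                           ≡⟨ harmonic u ⟩
            0ℤ                                       ∎)))
          where
          x = g (0 ∷ N ∷ u)
          F : ℕ → ℤ
          F j = form N j * g (j ∷ N ∸ j ∷ u)
          middle : ∀ {a} → a ℕ.< h ℕ.+ suc h → F (suc a) ≡ 0ℤ
          middle {a} a<N = ≡.trans (cong (form N (suc a) *_) (go k _ fewer)) (*-zeroʳ (form N (suc a)))
            where
            fewer : zeros (suc a ∷ h ℕ.+ suc h ∸ a ∷ u) ℕ.≤ k
            fewer with h ℕ.+ suc h ∸ a | ℕ.m<n⇒0<n∸m a<N
            ... | suc _ | _ = zu≤k

-- Enumeration of descending words and reduced words

module Words where

  open LinearSystems
  open Tensors
  open ≡-Reasoning

  -- Multiplication by qᵏ on coefficient sequences, with z in the role of 0. It is polymorphic so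
  -- that it shifts lists of words (z = []) and their counts alike.
  delay : ∀ {A : Set} → A → ℕ → (ℕ → A) → ℕ → A
  delay z zero    F i       = F i
  delay z (suc k) F zero    = z
  delay z (suc k) F (suc i) = delay z k F i

  delay-+ : ∀ {A : Set} (z : A) k F i → delay z k F (k ℕ.+ i) ≡ F i
  delay-+ z zero    F i = refl
  delay-+ z (suc k) F i = delay-+ z k F i

  delay-elim : ∀ {A : Set} (P : ℕ → A → Set) {z} k {F} → (∀ i → P i z) →
               (∀ i → P (k ℕ.+ i) (F i)) → ∀ i → P i (delay z k F i)
  delay-elim P zero    Pz PF i       = PF i
  delay-elim P (suc k) Pz PF zero    = Pz 0
  delay-elim P (suc k) Pz PF (suc i) = delay-elim (P ∘ suc) k (Pz ∘ suc) PF i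

  delay-map : ∀ {A B : Set} (g : A → B) z k F i → g (delay z k F i) ≡ delay (g z) k (g ∘ F) i
  delay-map g z zero    F i       = refl
  delay-map g z (suc k) F zero    = refl
  delay-map g z (suc k) F (suc i) = delay-map g z k F i

  Descending : Word → Set
  Descending = Linked ℕ._≥_

  -- The partitions of i in an m by N box, padded with zeros; they index a basis of the symmetric
  -- tensors of weight i. Splitting by whether the first letter is the maximal one gives the
  -- q-Pascal recursion.
  descending : ℕ → ℕ → ℕ → List Word
  descending N       zero    zero    = [] ∷ []
  descending N       zero    (suc i) = []
  descending zero    (suc m) i       = map (0 ∷_) (descending zero m i)
  descending (suc N) (suc m) i       =
    descending N (suc m) i ++ map (suc N ∷_) (delay [] (suc N) (descending (suc N) m) i)

  InBox : ℕ → ℕ → ℕ → Word → Set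
  InBox N m i w = All (ℕ._≤ N) w × length w ≡ m × sum w ≡ i

  inBox? : ∀ N m i w → Dec (InBox N m i w)
  inBox? N m i w = all? (ℕ._≤? N) w ×-dec (length w ℕ.≟ m ×-dec sum w ℕ.≟ i)

  InBox-resp-↭ : ∀ {N m i v w} → v ↭ w → InBox N m i v → InBox N m i w
  InBox-resp-↭ p (b , l , s) = All-resp-↭ p b , ≡.trans (sym (↭-length p)) l , ≡.trans (sym (sum-↭ p)) s

  ∷-descending : ∀ {j w} → All (ℕ._≤ j) w → Descending w → Descending (j ∷ w)
  ∷-descending []      []    = [-]
  ∷-descending (p ∷ _) desc = p ∷ desc

  descending-bounded : ∀ {j w} → Descending (j ∷ w) → All (ℕ._≤ j) (j ∷ w)
  descending-bounded desc = Linked.Linked⇒All (λ p q → ℕ.≤-trans q p) ℕ.≤-refl desc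

  descending-sound : ∀ N m i → All (λ w → Descending w × InBox N m i w) (descending N m i)
  descending-sound N       zero    zero    = ([] , [] , refl , refl) ∷ []
  descending-sound N       zero    (suc i) = []
  descending-sound zero    (suc m) i       = All.map⁺ (All.map
    (λ (d , b , l , s) → ∷-descending b d , z≤n ∷ b , cong suc l , s) (descending-sound zero m i))
  descending-sound (suc N) (suc m) i       = All.++⁺
    (All.map (λ (d , b , l , s) → d , All.map ℕ.m≤n⇒m≤1+n b , l , s) (descending-sound N (suc m) i))
    (All.map⁺ (delay-elim (λ i → All (λ w → Descending (suc N ∷ w) × InBox (suc N) (suc m) i (suc N ∷ w)))
      (suc N) (λ _ → [])
      (λ i → All.map
        (λ (d , b , l , s) → ∷-descending b d , ℕ.≤-refl ∷ b , cong suc l , cong (suc N ℕ.+_) s)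
        (descending-sound (suc N) m i))
      i))

  descending-complete : ∀ N m i {w} → Descending w → InBox N m i w → w ∈ descending N m i
  descending-complete N zero i {[]} d (b , l , refl) = here refl
  descending-complete zero (suc m) i {zero ∷ w} d (z≤n ∷ b , l , s) =
    ∈-map⁺ (0 ∷_) (descending-complete zero m i (Linked.tail d) (b , ℕ.suc-injective l , s))
  descending-complete (suc N) (suc m) i {j ∷ w} d (j≤1+N ∷ b , l , refl) with ℕ.m≤n⇒m<n∨m≡n j≤1+N
  ... | inj₁ (s≤s j≤N) = ∈-++⁺ˡ (descending-complete N (suc m) i d
          (All.map (λ p → ℕ.≤-trans p j≤N) (descending-bounded d) , l , refl))
  ... | inj₂ refl = ∈-++⁺ʳ (descending N (suc m) i) (∈-map⁺ (suc N ∷_)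
          (subst (w ∈_) (sym (delay-+ [] (suc N) (descending (suc N) m) (sum w)))
            (descending-complete (suc N) m (sum w) (Linked.tail d) (b , ℕ.suc-injective l , refl))))

  descending-unique : ∀ N m i → Unique (descending N m i)
  descending-unique N       zero    zero    = [] ∷ []
  descending-unique N       zero    (suc i) = []
  descending-unique zero    (suc m) i       = Unique.map⁺ ∷-injectiveʳ (descending-unique zero m i)
  descending-unique (suc N) (suc m) i       = Unique.++⁺ (descending-unique N (suc m) i)
    (Unique.map⁺ ∷-injectiveʳ (delay-elim (λ _ → Unique) (suc N) (λ _ → []) (descending-unique (suc N) m) i))
    disjoint
    where
    disjoint : ∀ {w} → ¬ (w ∈ descending N (suc m) i × w ∈ map (suc N ∷_) _)
    disjoint (w∈₁ , w∈₂) with _ , _ , refl ← ∈-map⁻ (suc N ∷_) w∈₂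
      with _ , 1+N≤N ∷ _ , _ ← All.lookup (descending-sound N (suc m) i) w∈₁ = ℕ.<-irrefl refl 1+N≤N

  -- The descending words of length suc m in the letters 0, …, suc N that do not
  -- contain both 0 and suc N.
  reduced : ℕ → ℕ → ℕ → List Word
  reduced N m i = descending N (suc m) i
    ++ map (λ w → suc N ∷ map suc w) (delay [] (suc N ℕ.+ m) (descending N m) i)

  positive-shift : ∀ w → 0 ∉ w → ∃ λ v → w ≡ map suc v
  positive-shift []          0∉w = [] , refl
  positive-shift (zero ∷ w)  0∉w = contradiction (here refl) 0∉w
  positive-shift (suc j ∷ w) 0∉w with v , refl ← positive-shift w (0∉w ∘ there) = j ∷ v , refl

  sum-map-suc : ∀ w → sum (map suc w) ≡ length w ℕ.+ sum w
  sum-map-suc []      = refl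
  sum-map-suc (j ∷ w) = cong suc (begin
    j ℕ.+ sum (map suc w)         ≡⟨ cong (j ℕ.+_) (sum-map-suc w) ⟩
    j ℕ.+ (length w ℕ.+ sum w)    ≡⟨ ℕ.+-assoc j (length w) (sum w) ⟨
    j ℕ.+ length w ℕ.+ sum w      ≡⟨ cong (ℕ._+ sum w) (ℕ.+-comm j (length w)) ⟩
    length w ℕ.+ j ℕ.+ sum w      ≡⟨ ℕ.+-assoc (length w) j (sum w) ⟩
    length w ℕ.+ (j ℕ.+ sum w)    ∎)

  -- If the first letter is below `suc N`, the word is in the first list. Otherwise 0 is absent, and
  -- the remaining letters can all be decreased by one.
  reduced-complete : ∀ N m i {w} → Descending w → InBox (suc N) (suc m) i w →
                     ¬ (0 ∈ w × suc N ∈ w) → w ∈ reduced N m i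
  reduced-complete N m i {j ∷ w} d (j≤1+N ∷ b , refl , refl) ¬both with ℕ.m≤n⇒m<n∨m≡n j≤1+N
  ... | inj₁ (s≤s j≤N) = ∈-++⁺ˡ (descending-complete N (suc m) i d
          (All.map (λ p → ℕ.≤-trans p j≤N) (descending-bounded d) , refl , refl))
  ... | inj₂ refl with v , refl ← positive-shift w (λ 0∈w → ¬both (there 0∈w , here refl)) =
    ∈-++⁺ʳ (descending N (suc m) i) (∈-map⁺ (λ w → suc N ∷ map suc w) (subst (v ∈_) at-v
      (descending-complete N (length v) (sum v)
        (Linked.map ℕ.s≤s⁻¹ (Linked.map⁻ (Linked.tail d)))
        (All.map ℕ.s≤s⁻¹ (All.map⁻ b) , refl , refl))))
    where
    -- The first letter contributes `suc N` to the sum, and decreasing the others takes one from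
    -- each of them; together they make up the delay.
    at-v : descending N (length v) (sum v) ≡
           delay [] (suc N ℕ.+ length (map suc v)) (descending N (length (map suc v))) (suc N ℕ.+ sum (map suc v))
    at-v = begin
      descending N (length v) (sum v)
        ≡⟨ delay-+ [] (suc N ℕ.+ length v) (descending N (length v)) (sum v) ⟨
      delay [] (suc N ℕ.+ length v) (descending N (length v)) (suc N ℕ.+ length v ℕ.+ sum v)
        ≡⟨ cong (delay [] (suc N ℕ.+ length v) (descending N (length v)))
             (≡.trans (ℕ.+-assoc (suc N) (length v) (sum v)) (cong (suc N ℕ.+_) (sym (sum-map-suc v)))) ⟩
      delay [] (suc N ℕ.+ length v) (descending N (length v)) (suc N ℕ.+ sum (map suc v))
        ≡⟨ cong (λ m → delay [] (suc N ℕ.+ m) (descending N m) (suc N ℕ.+ sum (map suc v))) (length-map suc v) ⟨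
      delay [] (suc N ℕ.+ length (map suc v)) (descending N (length (map suc v))) (suc N ℕ.+ sum (map suc v))  ∎

  -- Makes `x ∘ sort` a symmetric tensor for every x, with the values of x at descending words as
  -- its coordinates.
  sort-resp-↭ : ∀ {v w} → v ↭ w → sort v ≡ sort w
  sort-resp-↭ {v} {w} p = Pointwise-≡⇒≡ (↗↭↗⇒≋ (DecTotalOrder.totalOrder ≥-decTotalOrder)
    (sort-↗ v) (sort-↗ w) (↭⇒↭ₛ (trans (sort-↭ v) (trans p (↭-sym (sort-↭ w))))))

  sort-descending : ∀ {w} → Descending w → sort w ≡ w
  sort-descending {w} d = Pointwise-≡⇒≡ (↗↭↗⇒≋ (DecTotalOrder.totalOrder ≥-decTotalOrder)
    (sort-↗ w) d (↭⇒↭ₛ (sort-↭ w)))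

  -- The linear system for harmonic tensors killed by raising

  module _ (h k : ℕ) where
    private
      N = suc h ℕ.+ suc h
      m = suc (suc k)

    harmonicity raising : Word → (Word → ℤ) → ℤ
    harmonicity v x = contract N (x ∘ sort) v
    raising v x     = raise N (x ∘ sort) v

    -- Contraction removes two letters with sum N, so it is tested at words of length k and weight i
    -- - N. The raised tensor has weight i + 1 and is tested at reduced words only; `reduced` is
    -- indexed by one less than the top letter and the length.
    equations : ℕ → List ((Word → ℤ) → ℤ)
    equations i = map harmonicity (delay [] N (descending N k) i)
                  ++ map raising (reduced (h ℕ.+ suc h) (suc k) (suc i))

    equations-linear : ∀ i → All Linear (equations i)
    equations-linear i = All.++⁺
      (All.map⁺ (All.universal (λ v → precompose-linear sort (contract-linear N v)) (delay [] N (descending N k) i)))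
      (All.map⁺ (All.universal (λ v → precompose-linear sort (derive-linear (pull-linear N) v))
        (reduced (h ℕ.+ suc h) (suc k) (suc i))))

    -- Otherwise some nonzero symmetric f of degree m and weight i is harmonic,
    -- and raise f, being harmonic too, vanishes as its reduced coefficients do.
    enough-equations : ∀ i → 2 ℕ.* i ℕ.< m ℕ.* N → length (descending N m i) ℕ.≤ length (equations i)
    enough-equations i 2i<mN = ℕ.≮⇒≥ λ fewer →
      let x , supp , (a , a∈ , xa≢0) , solves =
            underdetermined (≡-dec ℕ._≟_) (descending N m i) (descending-unique N m i) (equations i)
              (equations-linear i)
              fewer
          contract≡0 , raise≡0 = All.++⁻ (map harmonicity (delay [] N (descending N k) i)) solves
      -- The word a is descending, hence fixed by `sort`, so the nonzero `x a` is a value of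
      -- `x ∘ sort`.
      in xa≢0 (≡.trans (cong x (sym (sort-descending (proj₁ (All.lookup (descending-sound N m i) a∈)))))
           (f≡0 x supp (All.map⁻ contract≡0) (All.map⁻ raise≡0) a))
      where
      module _ (x : Word → ℤ) (supp : SupportedOn (≡-dec ℕ._≟_) (descending N m i) x)
               (contract≡0 : All (λ v → contract N (x ∘ sort) v ≡ 0ℤ) (delay [] N (descending N k) i))
               (raise≡0 : All (λ v → raise N (x ∘ sort) v ≡ 0ℤ) (reduced (h ℕ.+ suc h) (suc k) (suc i))) where
        f : Tensor
        f = x ∘ sort

        f-sym : Symmetrical f
        f-sym p = cong x (sort-resp-↭ p)

        f-supp : ∀ w → ¬ InBox N m i w → f w ≡ 0ℤ
        f-supp w w∉ = supp λ sw∈ →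
          w∉ (InBox-resp-↭ (sort-↭ w) (proj₂ (All.lookup (descending-sound N m i) sw∈)))

        harmonic : ∀ w → contract N f w ≡ 0ℤ
        harmonic w with all? (ℕ._≤? N) w ×-dec (length w ℕ.≟ k ×-dec N ℕ.+ sum w ℕ.≟ i)
        ... | yes (b , l , refl) = ≡.trans (contract-sym N f-sym (↭-sym (sort-↭ w)))
          (All.lookup contract≡0 (subst (sort w ∈_) (sym (delay-+ [] N (descending N k) (sum w)))
            (descending-complete N k (sum w) (sort-↗ w) (InBox-resp-↭ (↭-sym (sort-↭ w)) (b , l , refl)))))
        -- The contraction at w reads f only at the words j, N - j, w, and these leave the support
        -- when w has a wrong letter, length or sum.
        ... | no outside = contract-local N {f} w λ {j} j≤N → f-supp _ λ where
          (_ ∷ _ ∷ b , l , s) → outside (b , ℕ.suc-injective (ℕ.suc-injective l) ,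
            ≡.trans (cong (ℕ._+ sum w) (sym (ℕ.m+[n∸m]≡n j≤N))) (≡.trans (ℕ.+-assoc j (N ∸ j) (sum w)) s))

        -- Excluding i = N from the relation is what keeps the raised letter `suc i` at most N.
        step-bounded : ∀ {v w} → Step (λ j i → j ≡ suc i × i ≢ N) v w → All (ℕ._≤ N) w → All (ℕ._≤ N) v
        step-bounded (here (refl , i≢N)) (i≤N ∷ b) = ℕ.≤∧≢⇒< i≤N i≢N ∷ b
        step-bounded (there s)           (j≤N ∷ b) = j≤N ∷ step-bounded s b

        raise-reduced : ∀ w → ¬ (0 ∈ w × N ∈ w) → raise N f w ≡ 0ℤ
        raise-reduced w ¬both with inBox? N m (suc i) w
        ... | yes w∈ = ≡.trans (derive-sym (pull-linear N) f-sym (↭-sym (sort-↭ w)))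
          (All.lookup raise≡0 (reduced-complete (h ℕ.+ suc h) (suc k) (suc i) (sort-↗ w)
            (InBox-resp-↭ (↭-sym (sort-↭ w)) w∈)
            λ (0∈ , N∈) → ¬both (∈-resp-↭ (sort-↭ w) 0∈ , ∈-resp-↭ (sort-↭ w) N∈)))
        ... | no w∉ = derive-local (pull-local N) w λ s → f-supp _ λ (b , l , e) →
          w∉ (step-bounded s b , ≡.trans (step-length s) l , ≡.trans (step-sum 0 1 proj₁ s) (cong suc e))

        f≡0 : ∀ w → f w ≡ 0ℤ
        f≡0 = raise-injective N i 2i<mN (λ w off → f-supp w (off ∘ proj₂))
          (harmonic-determined h (derive-sym (pull-linear N) f-sym)
            (λ w → ≡.trans (contract-raise N f w) (linear-0 (derive-linear (pull-linear N) w) harmonic))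
            raise-reduced)

-- Power series arithmetic and clearing denominators

module GeneratingFunctions where

  open import Data.Integer.Base using (_+_; _*_; _-_)
  open ≡-Reasoning
  open LinearSystems
  open Tensors using (Word)
  open Words

  delayed : ℕ → Series → Series
  delayed = delay 0ℤ

  delayed-linear : ∀ k i → Linear (λ f → delayed k f i)
  delayed-linear zero    i       = eval-linear i
  delayed-linear (suc k) zero    = 0-linear
  delayed-linear (suc k) (suc i) = delayed-linear k i

  delay-< : ∀ {A : Set} {z : A} {F k i} → i ℕ.< k → delay z k F i ≡ z
  delay-< {k = suc k} {zero}  _         = refl
  delay-< {k = suc k} {suc i} (s≤s i<k) = delay-< i<k

  delay-delay : ∀ {A : Set} {z : A} a b F i → delay z a (delay z b F) i ≡ delay z (a ℕ.+ b) F i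
  delay-delay zero    b F i       = refl
  delay-delay (suc a) b F zero    = refl
  delay-delay (suc a) b F (suc i) = delay-delay a b F i

  delayed-cong : ∀ k {f g} → f ≗ g → delayed k f ≗ delayed k g
  delayed-cong k f≗g i = delayed-linear k i .cong-≗ f≗g

  -- Multiplication by 1 - qᵏ.
  diff : ℕ → Series → Series
  diff k f i = f i - delayed k f i

  diff-cong : ∀ k {f g} → f ≗ g → diff k f ≗ diff k g
  diff-cong k f≗g i = cong₂ _-_ (f≗g i) (delayed-cong k f≗g i)

  delayed-diff : ∀ a b f i → delayed a (diff b f) i ≡ delayed a f i - delayed (a ℕ.+ b) f i
  delayed-diff a b f i = ≡.trans (linear-- (delayed-linear a i) f (delayed b f))
    (cong (delayed a f i -_) (delay-delay a b f i))

  -- The factor 1 - qᵇ⁺¹ has constant term 1, so each coefficient is recovered from the product and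
  -- earlier coefficients. Identities of fractions are thus proved after multiplication by the
  -- denominator.
  diff-injective : ∀ b {f g} → diff (suc b) f ≗ diff (suc b) g → f ≗ g
  diff-injective b {f} {g} eq = <-rec _ λ i rec → begin
    f i                                          ≡⟨ split (f i) (delayed (suc b) f i) ⟩
    diff (suc b) f i + delayed (suc b) f i       ≡⟨ cong₂ _+_ (eq i) (previous i rec) ⟩
    diff (suc b) g i + delayed (suc b) g i       ≡⟨ split (g i) (delayed (suc b) g i) ⟨
    g i                                          ∎
    where
    split : ∀ u v → u ≡ u - v + v
    split = solve-∀
    previous : ∀ i → (∀ {j} → j ℕ.< i → f j ≡ g j) → delayed (suc b) f i ≡ delayed (suc b) g i
    previous i rec with i ℕ.<? suc b
    ... | yes i<b = ≡.trans (delay-< i<b) (sym (delay-< i<b))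
    ... | no  i≮b with j , refl ← ℕ.m≤n⇒∃[o]m+o≡n (ℕ.≮⇒≥ i≮b) = begin
      delayed (suc b) f (suc b ℕ.+ j)  ≡⟨ delay-+ 0ℤ (suc b) f j ⟩
      f j                              ≡⟨ rec (s≤s (ℕ.m≤n+m j b)) ⟩
      g j                              ≡⟨ delay-+ 0ℤ (suc b) g j ⟨
      delayed (suc b) g (suc b ℕ.+ j)  ∎

  ⊛-linearˡ : ∀ g i → Linear (λ f → (f ⊛ g) i)
  ⊛-linearˡ g i = ∑-linear {n = suc i} (λ j f → f (toℕ j) * g (i ∸ toℕ j))
    λ j → *-linearʳ (g (i ∸ toℕ j)) (eval-linear (toℕ j))

  ⊛-linearʳ : ∀ f i → Linear (λ g → (f ⊛ g) i)
  ⊛-linearʳ f i = ∑-linear {n = suc i} (λ j g → f (toℕ j) * g (i ∸ toℕ j))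
    λ j → *-linear (f (toℕ j)) (eval-linear (i ∸ toℕ j))

  ⊛-identityˡ : ∀ g → q^ 0 ⊛ g ≗ g
  ⊛-identityˡ g zero    = ≡.trans (ℤ.+-identityʳ _) (ℤ.*-identityˡ (g 0))
  ⊛-identityˡ g (suc i) = ≡.trans
    (cong₂ _+_ (ℤ.*-identityˡ (g (suc i))) (linear-0 (⊛-linearˡ g i) (λ _ → refl)))
    (ℤ.+-identityʳ (g (suc i)))

  ⊛-identityʳ : ∀ f → f ⊛ q^ 0 ≗ f
  ⊛-identityʳ f zero    = ≡.trans (ℤ.+-identityʳ _) (ℤ.*-identityʳ (f 0))
  ⊛-identityʳ f (suc i) = ≡.trans (cong₂ _+_ (*-zeroʳ (f 0)) (⊛-identityʳ (f ∘ suc) i)) (+-identityˡ (f (suc i)))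

  delayed-⊛ˡ : ∀ k f g → delayed k f ⊛ g ≗ delayed k (f ⊛ g)
  delayed-⊛ˡ zero    f g i       = refl
  delayed-⊛ˡ (suc k) f g zero    = refl
  delayed-⊛ˡ (suc k) f g (suc i) = ≡.trans (+-identityˡ _) (delayed-⊛ˡ k f g i)

  delayed-⊛ʳ : ∀ k f g → f ⊛ delayed k g ≗ delayed k (f ⊛ g)
  delayed-⊛ʳ zero    f g i       = refl
  delayed-⊛ʳ (suc k) f g zero    = ≡.trans (ℤ.+-identityʳ _) (*-zeroʳ (f 0))
  delayed-⊛ʳ (suc k) f g (suc i) = ≡.trans (step f i) (delayed-⊛ʳ k f g i)
    where
    step : ∀ f i → (f ⊛ delayed (suc k) g) (suc i) ≡ (f ⊛ delayed k g) i
    step f zero    = cong (f 0 * delayed k g 0 +_) (≡.trans (ℤ.+-identityʳ _) (*-zeroʳ (f 1)))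
    step f (suc i) = cong (f 0 * delayed k g (suc i) +_) (step (f ∘ suc) i)

  q^-delayed : ∀ k → q^ k ≗ delayed k (q^ 0)
  q^-delayed zero    i       = refl
  q^-delayed (suc k) zero    = refl
  q^-delayed (suc k) (suc i) = q^-delayed k i

  1-q^-⊛ : ∀ k g → (1-q^ k) ⊛ g ≗ diff k g
  1-q^-⊛ k g i = begin
    ((1-q^ k) ⊛ g) i                        ≡⟨ linear-- (⊛-linearˡ g i) (q^ 0) (q^ k) ⟩
    (q^ 0 ⊛ g) i - (q^ k ⊛ g) i
      ≡⟨ cong₂ _-_ (⊛-identityˡ g i) (⊛-linearˡ g i .cong-≗ (q^-delayed k)) ⟩
    g i - (delayed k (q^ 0) ⊛ g) i          ≡⟨ cong (g i -_) (delayed-⊛ˡ k (q^ 0) g i) ⟩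
    g i - delayed k (q^ 0 ⊛ g) i            ≡⟨ cong (g i -_) (delayed-cong k (⊛-identityˡ g) i) ⟩
    g i - delayed k g i                     ∎

  diff-⊛ˡ : ∀ k f g → diff k (f ⊛ g) ≗ diff k f ⊛ g
  diff-⊛ˡ k f g i = sym (≡.trans (linear-- (⊛-linearˡ g i) f (delayed k f)) (cong ((f ⊛ g) i -_) (delayed-⊛ˡ k f g i)))

  diff-⊛ʳ : ∀ k f g → diff k (f ⊛ g) ≗ f ⊛ diff k g
  diff-⊛ʳ k f g i = sym (≡.trans (linear-- (⊛-linearʳ f i) g (delayed k g)) (cong ((f ⊛ g) i -_) (delayed-⊛ʳ k f g i)))

  -- Below b + 1 only 0 is divisible by b + 1; from there on, divisibility is periodic and the
  -- difference cancels.
  diff-geometric : ∀ b → diff (suc b) (geometric (suc b)) ≗ q^ 0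
  diff-geometric b i with i ℕ.<? suc b
  diff-geometric b zero | yes i<b
    rewrite dec-true (suc b ∣? 0) (suc b ∣0) = refl
  diff-geometric b (suc i) | yes i<b
    rewrite delay-< {z = 0ℤ} {geometric (suc b)} i<b | dec-false (suc b ∣? suc i) (>⇒∤ i<b) = refl
  diff-geometric b i | no i≮b with j , refl ← ℕ.m≤n⇒∃[o]m+o≡n (ℕ.≮⇒≥ i≮b) = begin
    geometric (suc b) (suc b ℕ.+ j) - delayed (suc b) (geometric (suc b)) (suc b ℕ.+ j)
      ≡⟨ cong₂ _-_ periodic (delay-+ 0ℤ (suc b) (geometric (suc b)) j) ⟩
    geometric (suc b) j - geometric (suc b) j
      ≡⟨ ℤ.+-inverseʳ (geometric (suc b) j) ⟩
    0ℤ  ∎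
    where
    periodic : geometric (suc b) (suc b ℕ.+ j) ≡ geometric (suc b) j
    periodic = cong (if_then 1ℤ else 0ℤ) (does-⇔
      (mk⇔ (λ b∣b+j → ∣m+n∣m⇒∣n b∣b+j ∣-refl) (∣m∣n⇒∣m+n ∣-refl)) (suc b ∣? suc b ℕ.+ j) (suc b ∣? j))

  diff-fraction-⊛ : ∀ a b g → diff (suc b) ((1-q^ a) /[1-q^ suc b ] ⊛ g) ≗ diff a g
  diff-fraction-⊛ a b g i = begin
    diff (suc b) ((1-q^ a) ⊛ geometric (suc b) ⊛ g) i    ≡⟨ diff-⊛ˡ (suc b) ((1-q^ a) ⊛ geometric (suc b)) g i ⟩
    (diff (suc b) ((1-q^ a) ⊛ geometric (suc b)) ⊛ g) i  ≡⟨ ⊛-linearˡ g i .cong-≗ quotient ⟩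
    ((1-q^ a) ⊛ g) i                                     ≡⟨ 1-q^-⊛ a g i ⟩
    diff a g i                                           ∎
    where
    quotient : diff (suc b) ((1-q^ a) ⊛ geometric (suc b)) ≗ 1-q^ a
    quotient i = begin
      diff (suc b) ((1-q^ a) ⊛ geometric (suc b)) i    ≡⟨ diff-⊛ʳ (suc b) (1-q^ a) (geometric (suc b)) i ⟩
      ((1-q^ a) ⊛ diff (suc b) (geometric (suc b))) i  ≡⟨ ⊛-linearʳ (1-q^ a) i .cong-≗ (diff-geometric b) ⟩
      ((1-q^ a) ⊛ q^ 0) i                              ≡⟨ ⊛-identityʳ (1-q^ a) i ⟩
      (1-q^ a) i                                       ∎

  -- Word counts as Gaussian polynomials and q-Kaplansky numbers

  box : ℕ → ℕ → Series
  box N m i = ℤ.+ length (descending N m i)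

  box-N-0 : ∀ N → box N 0 ≗ q^ 0
  box-N-0 N zero    = refl
  box-N-0 N (suc i) = refl

  box-0-suc : ∀ m → box 0 (suc m) ≗ box 0 m
  box-0-suc m i = cong ℤ.+_ (length-map (0 ∷_) (descending 0 m i))

  length-++-map-delay : ∀ (xs : List Word) g k (F : ℕ → List Word) i →
    ℤ.+ length (xs ++ map g (delay [] k F i)) ≡ ℤ.+ length xs + delayed k (λ i → ℤ.+ length (F i)) i
  length-++-map-delay xs g k F i = begin
    ℤ.+ length (xs ++ map g (delay [] k F i))                  ≡⟨ cong ℤ.+_ (length-++ xs) ⟩
    ℤ.+ length xs + ℤ.+ length (map g (delay [] k F i))
      ≡⟨ cong (λ n → ℤ.+ length xs + ℤ.+ n) (length-map g (delay [] k F i)) ⟩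
    ℤ.+ length xs + ℤ.+ length (delay [] k F i)
      ≡⟨ cong (ℤ.+ length xs +_) (delay-map (λ ys → ℤ.+ length ys) [] k F i) ⟩
    ℤ.+ length xs + delayed k (λ i → ℤ.+ length (F i)) i       ∎

  pascal : ∀ N m i → box (suc N) (suc m) i ≡ box N (suc m) i + delayed (suc N) (box (suc N) m) i
  pascal N m i = length-++-map-delay (descending N (suc m) i) (suc N ∷_) (suc N) (descending (suc N) m) i

  diff-+-delayed : ∀ a b f g {h} → (∀ i → h i ≡ f i + delayed b g i) →
                   ∀ i → diff a h i ≡ diff a f i + (delayed b g i - delayed (a ℕ.+ b) g i)
  diff-+-delayed a b f g {h} h≗ i = begin
    h i - delayed a h i
      ≡⟨ cong₂ _-_ (h≗ i) (≡.trans (delayed-cong a h≗ i) (linear-+ (delayed-linear a i) f (delayed b g))) ⟩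
    f i + delayed b g i - (delayed a f i + delayed a (delayed b g) i)
      ≡⟨ cong (λ x → f i + delayed b g i - (delayed a f i + x)) (delay-delay a b g i) ⟩
    f i + delayed b g i - (delayed a f i + delayed (a ℕ.+ b) g i)
      ≡⟨ regroup (f i) (delayed b g i) (delayed a f i) (delayed (a ℕ.+ b) g i) ⟩
    diff a f i + (delayed b g i - delayed (a ℕ.+ b) g i)  ∎
    where
    regroup : ∀ u v w x → u + v - (w + x) ≡ u - w + (v - x)
    regroup = solve-∀

  telescope : ∀ u v w → u - v + (v - w) ≡ u - w
  telescope = solve-∀

  -- The ratios of neighbouring Gaussian polynomials, proved by simultaneous induction. Pascal's
  -- rule writes the larger box through its neighbours f and g, and the two claims for the smaller
  -- box give (1 - qᵐ⁺¹) f = (1 - qᴺ⁺¹) g.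
  box-suc-m : ∀ N m → diff (suc m) (box N (suc m)) ≗ diff (suc (N ℕ.+ m)) (box N m)
  box-suc-N : ∀ N m → diff (suc N) (box (suc N) m) ≗ diff (suc (N ℕ.+ m)) (box N m)

  box-suc-m zero    m = diff-cong (suc m) (box-0-suc m)
  box-suc-m (suc N) m i = begin
    diff a (box (suc N) (suc m)) i                       ≡⟨ diff-+-delayed a b f g (pascal N m) i ⟩
    diff a f i + (delayed b g i - delayed (a ℕ.+ b) g i)
      ≡⟨ cong (_+ (delayed b g i - delayed (a ℕ.+ b) g i)) (≡.trans (box-suc-m N m i) (sym (box-suc-N N m i))) ⟩
    diff b g i + (delayed b g i - delayed (a ℕ.+ b) g i)
      ≡⟨ telescope (g i) (delayed b g i) (delayed (a ℕ.+ b) g i) ⟩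
    diff (a ℕ.+ b) g i
      ≡⟨ cong (λ k → diff k g i) (cong suc (≡.trans (ℕ.+-suc m N) (cong suc (ℕ.+-comm m N)))) ⟩
    diff (suc (suc N ℕ.+ m)) g i                         ∎
    where
    a = suc m
    b = suc N
    f = box N (suc m)
    g = box (suc N) m

  box-suc-N N zero i = ≡.trans (diff-cong (suc N) (λ i → ≡.trans (box-N-0 (suc N) i) (sym (box-N-0 N i))) i)
    (cong (λ k → diff (suc k) (box N 0) i) (sym (ℕ.+-identityʳ N)))
  box-suc-N N (suc m) i = begin
    diff b (box (suc N) (suc m)) i                        ≡⟨ diff-+-delayed b b f g (pascal N m) i ⟩
    diff b f i + (delayed b g i - delayed (b ℕ.+ b) g i)  ≡⟨ cong (diff b f i +_) (delayed-diff b b g i) ⟨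
    diff b f i + delayed b (diff b g) i
      ≡⟨ cong (diff b f i +_) (delayed-cong b (λ i → ≡.trans (box-suc-N N m i) (sym (box-suc-m N m i))) i) ⟩
    diff b f i + delayed b (diff a f) i                   ≡⟨ cong (diff b f i +_) (delayed-diff b a f i) ⟩
    diff b f i + (delayed b f i - delayed (b ℕ.+ a) f i)
      ≡⟨ telescope (f i) (delayed b f i) (delayed (b ℕ.+ a) f i) ⟩
    diff (suc (N ℕ.+ suc m)) f i                          ∎
    where
    a = suc m
    b = suc N
    f = box N (suc m)
    g = box (suc N) m

  -- Rearranges (1 - qᵃ) f = (1 - qᵇ) g, turning a decomposition f + qᵇ g into its mirror image g +
  -- qᵃ f.
  swap-diff : ∀ a b f g i → diff a f i ≡ diff b g i → f i + delayed b g i ≡ g i + delayed a f i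
  swap-diff a b f g i eq = begin
    f i + delayed b g i
      ≡⟨ regroup (f i) (delayed a f i) (delayed b g i) ⟩
    diff a f i + (delayed a f i + delayed b g i)
      ≡⟨ cong₂ _+_ eq (ℤ.+-comm (delayed a f i) (delayed b g i)) ⟩
    diff b g i + (delayed b g i + delayed a f i)
      ≡⟨ regroup (g i) (delayed b g i) (delayed a f i) ⟨
    g i + delayed a f i  ∎
    where
    regroup : ∀ u v x → u + x ≡ u - v + (v + x)
    regroup = solve-∀

  pascal′ : ∀ N m i → box (suc N) (suc m) i ≡ box (suc N) m i + delayed (suc m) (box N (suc m)) i
  pascal′ N m i = ≡.trans (pascal N m i)
    (swap-diff (suc m) (suc N) (box N (suc m)) (box (suc N) m) i
      (≡.trans (box-suc-m N m i) (sym (box-suc-N N m i))))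

  -- The first factor of the product is (1 - qᴺ⁺ᵐ⁺¹) / (1 - qᵐ⁺¹), and the rest is definitionally
  -- the Gaussian polynomial for N + m and m; `box-suc-m` gives the same ratio for boxes.
  gaussian-box : ∀ N m → gaussian (N ℕ.+ m) m ≗ box N m
  gaussian-box N zero    i = sym (box-N-0 N i)
  gaussian-box N (suc m) rewrite ℕ.+-suc N m = diff-injective m λ i → begin
    diff (suc m) (gaussian (suc (N ℕ.+ m)) (suc m)) i
      ≡⟨ diff-fraction-⊛ (suc (N ℕ.+ m)) m (gaussian (N ℕ.+ m) m) i ⟩
    diff (suc (N ℕ.+ m)) (gaussian (N ℕ.+ m) m) i      ≡⟨ diff-cong (suc (N ℕ.+ m)) (gaussian-box N m) i ⟩
    diff (suc (N ℕ.+ m)) (box N m) i                   ≡⟨ box-suc-m N m i ⟨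
    diff (suc m) (box N (suc m)) i                     ∎

  reducedSeries : ℕ → ℕ → Series
  reducedSeries N m i = ℤ.+ length (reduced N m i)

  reducedSeries-split : ∀ N m i →
    reducedSeries N m i ≡ box N (suc m) i + delayed (suc N ℕ.+ m) (box N m) i
  reducedSeries-split N m i =
    length-++-map-delay (descending N (suc m) i) (λ w → suc N ∷ map suc w) (suc N ℕ.+ m) (descending N m) i

  -- With s = N + m + 1, the numerator splits as (1 - qˢ) f + qˢ (1 - qᵐ⁺¹) f. By `box-suc-m` the
  -- second term is qˢ (1 - qˢ) c, so the quotient by 1 - qˢ is f + qˢ c.
  kaplansky-reduced : ∀ N m → kaplansky (suc (N ℕ.+ m)) (suc m) ≗ reducedSeries N m
  kaplansky-reduced N m = diff-injective (N ℕ.+ m) λ i → begin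
    diff s (kaplansky s (suc m)) i
      ≡⟨ diff-fraction-⊛ (s ℕ.+ suc m) (N ℕ.+ m) (gaussian s (suc m)) i ⟩
    diff (s ℕ.+ suc m) (gaussian s (suc m)) i
      ≡⟨ diff-cong (s ℕ.+ suc m) (subst (λ n → gaussian n (suc m) ≗ f) (ℕ.+-suc N m) (gaussian-box N (suc m))) i ⟩
    diff (s ℕ.+ suc m) f i
      ≡⟨ telescope (f i) (delayed s f i) (delayed (s ℕ.+ suc m) f i) ⟨
    diff s f i + (delayed s f i - delayed (s ℕ.+ suc m) f i)
      ≡⟨ cong (diff s f i +_) (delayed-diff s (suc m) f i) ⟨
    diff s f i + delayed s (diff (suc m) f) i
      ≡⟨ cong (diff s f i +_) (delayed-cong s (box-suc-m N m) i) ⟩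
    diff s f i + delayed s (diff s c) i                    ≡⟨ cong (diff s f i +_) (delayed-diff s s c i) ⟩
    diff s f i + (delayed s c i - delayed (s ℕ.+ s) c i)
      ≡⟨ diff-+-delayed s s f c (reducedSeries-split N m) i ⟨
    diff s (reducedSeries N m) i                           ∎
    where
    s = suc (N ℕ.+ m)
    f = box N (suc m)
    c = box N m

  -- The last term accounts for the words with both 0 and `suc N`: dropping one of each leaves a
  -- word two letters shorter and `suc N` lighter. It is also the number of harmonicity equations.
  box-reduced : ∀ N m i →
    box (suc N) (suc (suc m)) i ≡ reducedSeries N (suc m) i + delayed (suc N) (box (suc N) m) i
  box-reduced N m i = begin
    box b (suc (suc m)) i
      ≡⟨ pascal N (suc m) i ⟩
    f i + delayed b (box b (suc m)) i
      ≡⟨ cong (f i +_) (delayed-cong b (pascal′ N m) i) ⟩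
    f i + delayed b (λ i → box b m i + delayed (suc m) (box N (suc m)) i) i
      ≡⟨ cong (f i +_) (linear-+ (delayed-linear b i) (box b m) _) ⟩
    f i + (delayed b (box b m) i + delayed b (delayed (suc m) (box N (suc m))) i)
      ≡⟨ cong (λ x → f i + (delayed b (box b m) i + x)) (delay-delay b (suc m) (box N (suc m)) i) ⟩
    f i + (delayed b (box b m) i + delayed (b ℕ.+ suc m) (box N (suc m)) i)
      ≡⟨ regroup (f i) (delayed b (box b m) i) _ ⟩
    f i + delayed (b ℕ.+ suc m) (box N (suc m)) i + delayed b (box b m) i
      ≡⟨ cong (_+ delayed b (box b m) i) (reducedSeries-split N (suc m) i) ⟨
    reducedSeries N (suc m) i + delayed b (box b m) i  ∎
    where
    b = suc N
    f = box N (suc (suc m))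
    regroup : ∀ u v w → u + (v + w) ≡ u + w + v
    regroup = solve-∀

  -- Palindromic coefficients and unimodality

  Palindromic : ℕ → Series → Set
  Palindromic D f = (∀ i j → i ℕ.+ j ≡ D → f i ≡ f j) × PolynomialUpTo D f

  -- Reversing qᵏ f within degree D + k gives back f. At i = 0 with a positive delay, j exceeds D,
  -- so both sides are 0.
  delayed-reverse : ∀ {D f} → Palindromic D f → ∀ k i j → i ℕ.+ j ≡ D ℕ.+ k → delayed k f i ≡ f j
  delayed-reverse {D} (rev , _) zero    i       j eq   = rev i j (≡.trans eq (ℕ.+-identityʳ D))
  delayed-reverse {D} (_ , top) (suc k) zero    j refl = sym (top j (ℕ.m<m+n D (s≤s z≤n)))
  delayed-reverse {D} pal       (suc k) (suc i) j eq   =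
    delayed-reverse pal k i j (ℕ.suc-injective (≡.trans eq (ℕ.+-suc D k)))

  delayed-top : ∀ {D f} → PolynomialUpTo D f → ∀ k → PolynomialUpTo (D ℕ.+ k) (delayed k f)
  delayed-top {D} top zero    i       D<i = top i (subst (ℕ._< i) (ℕ.+-identityʳ D) D<i)
  delayed-top {D} top (suc k) zero    D<i = refl
  delayed-top {D} top (suc k) (suc i) D<i = delayed-top top k i (ℕ.s≤s⁻¹ (subst (ℕ._< suc i) (ℕ.+-suc D k) D<i))

  -- Reversal exchanges the two Pascal-type decompositions of h.
  palindromic-sum : ∀ {D D₁ D₂ a b f g h} → Palindromic D₁ f → Palindromic D₂ g → D ≡ D₁ ℕ.+ a → D ≡ D₂ ℕ.+ b →
    (∀ i → h i ≡ f i + delayed b g i) → (∀ i → h i ≡ g i + delayed a f i) → Palindromic D h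
  palindromic-sum {D} {D₁} {D₂} {a} {b} {f} {g} {h} f-pal g-pal D≡₁ D≡₂ h≗ h≗′ = reverse , top
    where
    reverse : ∀ i j → i ℕ.+ j ≡ D → h i ≡ h j
    reverse i j i+j≡D = begin
      h i                    ≡⟨ h≗ i ⟩
      f i + delayed b g i
        ≡⟨ cong₂ _+_ (sym (delayed-reverse f-pal a j i (≡.trans (ℕ.+-comm j i) (≡.trans i+j≡D D≡₁))))
                                          (delayed-reverse g-pal b i j (≡.trans i+j≡D D≡₂)) ⟩
      delayed a f j + g j    ≡⟨ ℤ.+-comm (delayed a f j) (g j) ⟩
      g j + delayed a f j    ≡⟨ h≗′ j ⟨
      h j                    ∎
    top : PolynomialUpTo D h
    top i D<i = ≡.trans (h≗ i) (cong₂ _+_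
      (proj₂ f-pal i (ℕ.≤-<-trans (ℕ.≤-trans (ℕ.m≤m+n D₁ a) (ℕ.≤-reflexive (sym D≡₁))) D<i))
      (delayed-top (proj₂ g-pal) b i (subst (ℕ._< i) D≡₂ D<i)))

  palindromic-cong : ∀ {D f g} → f ≗ g → Palindromic D f → Palindromic D g
  palindromic-cong f≗g (rev , top) =
    (λ i j eq → ≡.trans (sym (f≗g i)) (≡.trans (rev i j eq) (f≗g j))) , λ i D<i → ≡.trans (sym (f≗g i)) (top i D<i)

  box-palindromic : ∀ N m → Palindromic (m ℕ.* N) (box N m)
  box-palindromic N zero = (λ { zero zero _ → refl }) , λ { (suc i) _ → refl }
  box-palindromic zero (suc m) = palindromic-cong (sym ∘ box-0-suc m) (box-palindromic zero m)
  box-palindromic (suc N) (suc m) = palindromic-sum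
    (box-palindromic N (suc m)) (box-palindromic (suc N) m)
    (≡.trans (ℕ.*-suc (suc m) N) (ℕ.+-comm (suc m) (suc m ℕ.* N))) (ℕ.+-comm (suc N) (m ℕ.* suc N))
    (pascal N m) (pascal′ N m)

  reducedSeries-palindromic : ∀ N m → Palindromic (suc m ℕ.* suc N) (reducedSeries N m)
  reducedSeries-palindromic N m = palindromic-sum
    (box-palindromic N (suc m)) (box-palindromic N m)
    (≡.trans (ℕ.*-suc (suc m) N) (ℕ.+-comm (suc m) (suc m ℕ.* N))) degree
    (reducedSeries-split N m)
    (λ i → ≡.trans (reducedSeries-split N m i) 
      (swap-diff (suc m) (suc (N ℕ.+ m)) (box N (suc m)) (box N m) i (box-suc-m N m i)))
    where
    degree : suc m ℕ.* suc N ≡ m ℕ.* N ℕ.+ (suc N ℕ.+ m)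
    degree = begin
      suc N ℕ.+ m ℕ.* suc N        ≡⟨ cong (suc N ℕ.+_) (ℕ.*-suc m N) ⟩
      suc N ℕ.+ (m ℕ.+ m ℕ.* N)    ≡⟨ ℕ.+-assoc (suc N) m (m ℕ.* N) ⟨
      suc N ℕ.+ m ℕ.+ m ℕ.* N      ≡⟨ ℕ.+-comm (suc N ℕ.+ m) (m ℕ.* N) ⟩
      m ℕ.* N ℕ.+ (suc N ℕ.+ m)    ∎

  -- There are r i + d unknowns and r (i + 1) + d equations, where d counts the harmonicity
  -- equations; `enough-equations` compares the two, and d cancels.
  reducedSeries-mono : ∀ h k i → let N = h ℕ.+ suc h in 2 ℕ.* i ℕ.< suc (suc k) ℕ.* suc N →
    reducedSeries N (suc k) i ℤ.≤ reducedSeries N (suc k) (suc i)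
  reducedSeries-mono h k i 2i<D = ≡.subst₂ ℤ._≤_ (cancel (r i) d) (cancel (r (suc i)) d)
    (ℤ.+-monoˡ-≤ (ℤ.- d) (≡.subst₂ ℤ._≤_ (box-reduced N k i) count (ℤ.+≤+ (enough-equations h k i 2i<D))))
    where
    N = h ℕ.+ suc h
    r = reducedSeries N (suc k)
    d = delayed (suc N) (box (suc N) k) i
    cancel : ∀ u v → u + v - v ≡ u
    cancel = solve-∀
    harmonicities = map (harmonicity h k) (delay [] (suc N) (descending (suc N) k) i)
    raisings = map (raising h k) (reduced N (suc k) (suc i))
    count : ℤ.+ length (equations h k i) ≡ r (suc i) + d
    count = begin
      ℤ.+ length (harmonicities ++ raisings)
        ≡⟨ cong ℤ.+_ (≡.trans (length-++ harmonicities) (ℕ.+-comm (length harmonicities) (length raisings))) ⟩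
      ℤ.+ length raisings + ℤ.+ length harmonicities
        ≡⟨ cong₂ (λ x y → ℤ.+ x + ℤ.+ y) (length-map (raising h k) (reduced N (suc k) (suc i)))
             (length-map (harmonicity h k) (delay [] (suc N) (descending (suc N) k) i)) ⟩
      r (suc i) + ℤ.+ length (delay [] (suc N) (descending (suc N) k) i)
        ≡⟨ cong (r (suc i) +_) (delay-map (λ ys → ℤ.+ length ys) [] (suc N) (descending (suc N) k) i) ⟩
      r (suc i) + d  ∎

  -- The degree is even with midpoint e. The step from i to i + 1 above the midpoint mirrors the
  -- step from j to j + 1 below it, for j = D - i - 1.
  symmetric-unimodal : ∀ e {f} → Palindromic (e ℕ.+ e) f → (∀ i → 2 ℕ.* i ℕ.< e ℕ.+ e → f i ℤ.≤ f (suc i)) →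
    PolynomialUpTo (e ℕ.+ e) f × Symmetric (e ℕ.+ e) f × Unimodal (e ℕ.+ e) f
  symmetric-unimodal e {f} (reverse , top) increasing =
    top , (λ i i≤D → reverse i (D ∸ i) (ℕ.m+[n∸m]≡n i≤D)) ,
    (λ i i<e → increasing i (double-< (subst (i ℕ.<_) (sym (ℕ.n≡⌊n+n/2⌋ e)) i<e))) ,
    λ i e≤i i<D → decreasing i (subst (ℕ._≤ i) (sym (ℕ.n≡⌊n+n/2⌋ e)) e≤i) i<D
    where
    D = e ℕ.+ e
    double-< : ∀ {i} → i ℕ.< e → 2 ℕ.* i ℕ.< D
    double-< {i} i<e = subst (ℕ._< D) (cong (i ℕ.+_) (sym (ℕ.+-identityʳ i))) (ℕ.+-mono-< i<e i<e)
    decreasing : ∀ i → e ℕ.≤ i → i ℕ.< D → f (suc i) ℤ.≤ f i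
    decreasing i e≤i i<D = ℤ.≤-trans (ℤ.≤-reflexive (reverse (suc i) j si+j≡D))
      (ℤ.≤-trans (increasing j (double-< j<e)) (ℤ.≤-reflexive
        (reverse (suc j) i (≡.trans (cong suc (ℕ.+-comm j i)) si+j≡D))))
      where
      j = D ∸ suc i
      si+j≡D : suc i ℕ.+ j ≡ D
      si+j≡D = ℕ.m+[n∸m]≡n i<D
      j<e : j ℕ.< e
      j<e = ℕ.+-cancelˡ-< i j e (ℕ.≤-trans (ℕ.≤-reflexive si+j≡D) (ℕ.+-monoˡ-≤ e e≤i))

  symmetric-unimodal-cong : ∀ {D f g} → f ≗ g →
    PolynomialUpTo D f × Symmetric D f × Unimodal D f → PolynomialUpTo D g × Symmetric D g × Unimodal D g
  symmetric-unimodal-cong {D} {f} {g} f≗g (top , symm , up , down) =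
    (λ i D<i → ≡.trans (sym (f≗g i)) (top i D<i)) ,
    (λ i i≤D → ≡.trans (sym (f≗g i)) (≡.trans (symm i i≤D) (f≗g (D ∸ i)))) ,
    (λ i i< → ≡.subst₂ ℤ._≤_ (f≗g i) (f≗g (suc i)) (up i i<)) ,
    (λ i ≤i i< → ≡.subst₂ ℤ._≤_ (f≗g (suc i)) (f≗g i) (down i ≤i i<))

-- Specialisation to n - m odd

open import Data.Nat.Base using (_+_; _*_; _≤_; _<_)
open GeneratingFunctions
open ≡-Reasoning

theorem1p5 : (n m : ℕ) → 2 ≤ m → m ≤ n → (n ∸ m) % 2 ≡ 1 →
    let D = m * (n ∸ m) + m in
    PolynomialUpTo D (kaplansky n m) × Symmetric D (kaplansky n m) × Unimodal D (kaplansky n m)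
theorem1p5 n (suc (suc k)) (s≤s (s≤s z≤n)) m≤n odd =
  subst (λ D → PolynomialUpTo D K × Symmetric D K × Unimodal D K) e+e≡D
    (symmetric-unimodal-cong r≗K (symmetric-unimodal e
      (subst (λ D → Palindromic D r) D≡e+e (reducedSeries-palindromic N (suc k)))
      λ i 2i<e+e → reducedSeries-mono h k i (subst (2 * i <_) (sym D≡e+e) 2i<e+e)))
  where
  m = suc (suc k)
  -- Oddness gives n - m = 2 h + 1 = N, so the top letter `suc N` is the even number 2 (h + 1), and
  -- e is half the degree D.
  h = (n ∸ m) / 2
  N = h + suc h
  e = m * suc h
  K = kaplansky n m
  r = reducedSeries N (suc k)

  n∸m≡N : n ∸ m ≡ N
  n∸m≡N = begin
    n ∸ m                ≡⟨ m≡m%n+[m/n]*n (n ∸ m) 2 ⟩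
    (n ∸ m) % 2 + h * 2  ≡⟨ cong₂ _+_ odd (≡.trans (ℕ.*-comm h 2) (cong (h +_) (ℕ.+-identityʳ h))) ⟩
    suc (h + h)          ≡⟨ ℕ.+-suc h h ⟨
    N                    ∎

  n≡N+m : n ≡ suc (N + suc k)
  n≡N+m = begin
    n                ≡⟨ ℕ.m∸n+n≡m m≤n ⟨
    n ∸ m + m        ≡⟨ cong (_+ m) n∸m≡N ⟩
    N + m            ≡⟨ ℕ.+-suc N (suc k) ⟩
    suc (N + suc k)  ∎

  r≗K : r ≗ K
  r≗K i = ≡.trans (sym (kaplansky-reduced N (suc k) i)) (cong (λ n → kaplansky n m i) (sym n≡N+m))

  D≡e+e : m * suc N ≡ e + e
  D≡e+e = ℕ.*-distribˡ-+ m (suc h) (suc h)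

  e+e≡D : e + e ≡ m * (n ∸ m) + m
  e+e≡D = begin
    e + e            ≡⟨ D≡e+e ⟨
    m * suc N        ≡⟨ ℕ.*-suc m N ⟩
    m + m * N        ≡⟨ ℕ.+-comm m (m * N) ⟩
    m * N + m        ≡⟨ cong (λ l → m * l + m) n∸m≡N ⟨
    m * (n ∸ m) + m  ∎
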